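{- Define integers $f(n)$ by \[ \sum_{n=0}^{\infty}f(n)q^n=\prod_{i\ge 1}\frac{1+q^{2i-1}}{(1-q^{4i})(1+q^{4i-2})^2}. \] Then for every $n\ge 0$, $f(n)$ equals the number of partitions of $n$ with an even number of even hooks minus the number of partitions of $n$ with an odd number of even hooks.
   Context: For a cell $(i,j)$ of the Young diagram of a partition $\lambda$ (with conjugate $\lambda'$), its hook length is $\lambda_i-j+\lambda'_j-i+1$. An even hook is a cell whose hook length is even; the number of even hooks of $\lambda$ is the number of such cells. -}

module Defs where

open import Data.Nat using (ℕ; zero; suc; _+_; _*_; _∸_; _≡ᵇ_; _≤ᵇ_; _%_)
open import Data.Integer as ℤ using (ℤ; +_; -_)
open import Data.List using (List; []; _∷_; length; map; foldr; filter; upTo; concatMap; applyUpTo)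
open import Data.Nat.ListAction using (sum)
open import Data.Product using (_×_; _,_; proj₁; proj₂)
open import Data.Bool using (Bool; true; false; if_then_else_; _∧_; not)
open import Relation.Binary.PropositionalEquality using (_≡_)
open import Relation.Nullary using (Dec; yes; no)
open import Relation.Nullary.Decidable using (⌊_⌋)
open import Data.Nat.Properties using (_≥?_; _≟_)

-- Formal power series over ℤ in one variable q, as coefficient sequences.

Series : Set
Series = ℕ → ℤ

Σ≤ : ℕ → (ℕ → ℤ) → ℤ
Σ≤ n f = foldr ℤ._+_ (+ 0) (map f (upTo (suc n)))

[_] : Bool → ℤ
[ true ] = + 1
[ false ] = + 0

mono : ℕ → Series
mono m n = [ n ≡ᵇ m ]

_⊕_ : Series → Series → Series
(a ⊕ b) n = a n ℤ.+ b n

_⊛_ : Series → Series → Series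
(a ⊛ b) n = Σ≤ n (λ k → a k ℤ.* b (n ∸ k))

oneS : Series
oneS = mono 0

-- 1/(1 - q^m) = Σ_{k ≥ 0} q^{m k}   (m ≥ 1)
invOneMinus : ℕ → Series
invOneMinus m n = Σ≤ n (λ k → [ m * k ≡ᵇ n ])

-- 1/(1 + q^m) = Σ_{k ≥ 0} (-1)^k q^{m k}   (m ≥ 1)
signPow : ℕ → ℤ
signPow zero = + 1
signPow (suc k) = - signPow k

invOnePlus : ℕ → Series
invOnePlus m n = Σ≤ n (λ k → signPow k ℤ.* [ m * k ≡ᵇ n ])

factor : ℕ → Series
factor i = (oneS ⊕ mono (2 * i ∸ 1))
         ⊛ (invOneMinus (4 * i) ⊛ (invOnePlus (4 * i ∸ 2) ⊛ invOnePlus (4 * i ∸ 2)))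

partialProd : ℕ → Series
partialProd zero = oneS
partialProd (suc N) = partialProd N ⊛ factor (suc N)

-- f(n) = coefficient of q^n in the infinite product.  Factors with i > n
-- are ≡ 1 mod q^{n+1}, so the coefficient of q^n of the infinite product
-- equals that of the partial product over i = 1..n.
f : ℕ → ℤ
f n = partialProd n n

-- Partitions: weakly decreasing lists of positive integers.

Partition : Set
Partition = List ℕ

decreasingᵇ : List ℕ → Bool
decreasingᵇ [] = true
decreasingᵇ (x ∷ []) = true
decreasingᵇ (x ∷ y ∷ xs) = (y ≤ᵇ x) ∧ decreasingᵇ (y ∷ xs)

positiveᵇ : List ℕ → Bool
positiveᵇ [] = true
positiveᵇ (x ∷ xs) = (1 ≤ᵇ x) ∧ positiveᵇ xs

isPartitionOfᵇ : ℕ → List ℕ → Bool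
isPartitionOfᵇ n λs = decreasingᵇ λs ∧ positiveᵇ λs ∧ (sum λs ≡ᵇ n)

candidates : ℕ → ℕ → List (List ℕ)
candidates b zero = [] ∷ []
candidates b (suc len) =
  [] ∷ concatMap (λ x → map (x ∷_) (candidates b len)) (applyUpTo suc b)

-- the list of all partitions of n (each appears exactly once)
partitions : ℕ → List Partition
partitions n = filter (λ λs → isPartitionOfᵇ n λs Data.Bool.≟ true) (candidates n n)
  where import Data.Bool

-- λ_i (1-indexed; 0 outside)
part : Partition → ℕ → ℕ
part [] i = 0
part (x ∷ xs) zero = 0
part (x ∷ xs) (suc zero) = x
part (x ∷ xs) (suc (suc i)) = part xs (suc i)

conj : Partition → ℕ → ℕ
conj λs j = length (filter (λ x → x ≥? j) λs)

hook : Partition → ℕ → ℕ → ℕ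
hook λs i j = part λs i ∸ j + conj λs j ∸ i + 1

evenᵇ : ℕ → Bool
evenᵇ n = n % 2 ≡ᵇ 0

cells : Partition → List (ℕ × ℕ)
cells λs = concatMap (λ i → map (λ j → (i , j)) (applyUpTo suc (part λs i)))
                     (applyUpTo suc (length λs))

evenHooks : Partition → ℕ
evenHooks λs = length (filter (λ c → evenᵇ (hook λs (proj₁ c) (proj₂ c)) Data.Bool.≟ true) (cells λs))
  where import Data.Bool

numEvenEH : ℕ → ℕ
numEvenEH n = length (filter (λ λs → evenᵇ (evenHooks λs) Data.Bool.≟ true) (partitions n))
  where import Data.Bool

numOddEH : ℕ → ℕ
numOddEH n = length (filter (λ λs → evenᵇ (evenHooks λs) Data.Bool.≟ false) (partitions n))
  where import Data.Bool

{-# OPTIONS --safe #-}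

-- Pad a partition λ with zeros to L parts and put βⱼ = λⱼ + (L − j).  The hook
-- lengths in row j are the βⱼ − v with 0 ≤ v < βⱼ not a β-number, so the row has
-- ⌊βⱼ/2⌋ − #{k > j : βₖ ≡ βⱼ mod 2} even hooks.  Summing (−1)^(even hooks) q^|λ|
-- over subsets of β-numbers, separately for even and odd ones, gives with p = −q²
--
--   Σ_{λ ⊆ n×n} (−1)^(even hooks) q^|λ|  =  Σ_{a+b=n} q^C(a−b,2) [n,a]ₚ [n,b]ₚ.
--
-- Modulo q^(n+1) each Gaussian binomial may be replaced by 1/(p;p)_∞, because the
-- error has order 2 min(a,b) + 2 and C(a−b,2) makes up for the rest.  What remains
-- is θ = Σ_{a+b=n} q^C(a−b,2), and the finite Jacobi triple product
--
--   Σ_{a+b=n} q^C(a−b,2) [n,a]_{q⁴}  =  ∏_{i≤n} (1 + q^(2i−1)),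
--
-- treated in the same way, gives θ ≡ ∏ (1 + q^(2i−1)) (1 − q^(4i)).  Finally
-- (p;p)_∞ = ∏ (1 − q^(4i)) (1 + q^(4i−2)).
module Submission where

open import Defs
open import Data.Nat using (ℕ)
open import Data.Integer using (ℤ; +_)
open import Relation.Binary.PropositionalEquality using (_≡_)

open import Algebra.Bundles using (CommutativeRing)
import Algebra.Properties.Ring as RingProperties
import Algebra.Solver.Ring.NaturalCoefficients.Default as NaturalCoefficients
open import Data.Bool as Bool using (Bool; true; false; not; _∧_; if_then_else_)
open import Data.Bool.Properties using (not-involutive; ∧-assoc; T-≡)
import Data.Integer as ℤ
import Data.Integer.Properties as ℤₚ
import Data.Integer.Tactic.RingSolver as ℤSolver
open import Data.List using (List; []; _∷_; _∷ʳ_; _++_; length; map; filter; foldr; concatMap; applyUpTo)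
open import Data.List.Properties using (filter-++; length-++; map-++; concatMap-++; ++-identityʳ; map-applyUpTo; applyUpTo-∷ʳ; filter-accept; filter-reject)
open import Data.Nat as ℕ using (zero; suc; _∸_; _≡ᵇ_; _≤ᵇ_; _≤_; _<_; z≤n; s≤s; ⌊_/2⌋; ⌈_/2⌉)
open import Data.Nat.ListAction using (sum)
import Data.Nat.Properties as ℕₚ
open import Data.Nat.Tactic.RingSolver using (solve-∀)
open import Data.Product using (∃; _×_; _,_; proj₁; proj₂)
open import Data.Sum using (_⊎_; inj₁; inj₂; [_,_]′)
open import Function using (_∘_; Equivalence)
open import Level using (0ℓ)
open import Relation.Binary.PropositionalEquality as ≡ using (_≢_; cong; cong₂; subst; subst₂)
import Relation.Binary.Reasoning.Setoid as SetoidReasoning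
open import Relation.Nullary using (contradiction)

-- A β-number β enters with (-1)^⌊β/2⌋ q^β, which is p^v for β = 2v and q p^v for β = 2v + 1; this
-- is where p = -q² comes from. In an n × n box the β-numbers are any n of 0, ..., 2n - 1, half of
-- which are even, so a even ones sum to p^C(a,2) [n,a]ₚ and b odd ones to q^b p^C(b,2) [n,b]ₚ. The
-- pairs of equal parity subtracted from the floors contribute (-1)^(C(a,2) + C(b,2)), which cancels
-- the sign of p^(C(a,2) + C(b,2)), and |λ| is the sum of the β-numbers less C(n,2). The exponent
-- that remains, a(a-1) + b² - C(a+b,2), is C(a-b,2). No sum over subsets is formed, however: the
-- identity is proved for all boxes by induction, Pascal's rule for one of the two binomials
-- matching the choice whether the largest possible β-number occurs. Every partition of n fits into
-- the n × n box, and `f n` is read off a product of n factors, so all of this takes place in a ring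
-- where q^i = 0 for i > n, without limits.

Σ≤-suc : ∀ n g → Σ≤ (suc n) g ≡ g 0 ℤ.+ Σ≤ n (g ∘ suc)
Σ≤-suc n g = cong (λ xs → g 0 ℤ.+ foldr ℤ._+_ (+ 0) xs)
  (≡.trans (map-applyUpTo suc g (suc n)) (≡.sym (map-applyUpTo (λ k → k) (g ∘ suc) (suc n))))

Σ≤-cong : ∀ n {g h} → (∀ k → k ≤ n → g k ≡ h k) → Σ≤ n g ≡ Σ≤ n h
Σ≤-cong zero g≡h = cong (ℤ._+ (+ 0)) (g≡h 0 z≤n)
Σ≤-cong (suc n) {g} {h} g≡h = begin
  Σ≤ (suc n) g                ≡⟨ Σ≤-suc n g ⟩
  g 0 ℤ.+ Σ≤ n (g ∘ suc)      ≡⟨ cong₂ ℤ._+_ (g≡h 0 z≤n) (Σ≤-cong n (λ k k≤n → g≡h (suc k) (s≤s k≤n))) ⟩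
  h 0 ℤ.+ Σ≤ n (h ∘ suc)      ≡⟨ Σ≤-suc n h ⟨
  Σ≤ (suc n) h                ∎
  where open ≡.≡-Reasoning

Σ≤-zero : ∀ n g → (∀ k → k ≤ n → g k ≡ + 0) → Σ≤ n g ≡ + 0
Σ≤-zero zero g g≡0 = cong (ℤ._+ (+ 0)) (g≡0 0 z≤n)
Σ≤-zero (suc n) g g≡0 = ≡.trans (Σ≤-suc n g)
  (cong₂ ℤ._+_ (g≡0 0 z≤n) (Σ≤-zero n (g ∘ suc) (λ k k≤n → g≡0 (suc k) (s≤s k≤n))))

-- Formal power series modulo q^(n+1)

infix 4 _≈[_]_

-- A record rather than a function type, so that unification can recover both series and the bound
-- from a proof.
record _≈[_]_ (a : Series) (n : ℕ) (b : Series) : Set where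
  constructor agree
  field coeff : ∀ k → k ≤ n → a k ≡ b k
open _≈[_]_

zeroS : Series
zeroS _ = + 0

⊖_ : Series → Series
(⊖ a) n = ℤ.- a n

-- Commutativity, associativity and distributivity of `⊛` are proved by induction on the coefficient
-- index, with each series split as `a 0` plus q times its tail.
tail : Series → Series
tail a n = a (suc n)

⊛-zero : ∀ a b → (a ⊛ b) 0 ≡ a 0 ℤ.* b 0
⊛-zero a b = ℤₚ.+-identityʳ _

⊛-suc : ∀ a b n → (a ⊛ b) (suc n) ≡ a 0 ℤ.* b (suc n) ℤ.+ (tail a ⊛ b) n
⊛-suc a b n = Σ≤-suc n (λ k → a k ℤ.* b (suc n ∸ k))

-- Splits the second factor where `⊛-suc` splits the first; commutativity comes from comparing the
-- two recursions.
⊛-suc′ : ∀ a b n → (a ⊛ b) (suc n) ≡ (a ⊛ tail b) n ℤ.+ a (suc n) ℤ.* b 0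
⊛-suc′ a b zero = begin
  (a ⊛ b) 1                               ≡⟨ ⊛-suc a b 0 ⟩
  a 0 ℤ.* b 1 ℤ.+ (tail a ⊛ b) 0          ≡⟨ cong₂ ℤ._+_ (≡.sym (⊛-zero a (tail b))) (⊛-zero (tail a) b) ⟩
  (a ⊛ tail b) 0 ℤ.+ a 1 ℤ.* b 0          ∎
  where open ≡.≡-Reasoning
⊛-suc′ a b (suc n) = begin
  (a ⊛ b) (suc (suc n))                                                     ≡⟨ ⊛-suc a b (suc n) ⟩
  a 0 ℤ.* b (suc (suc n)) ℤ.+ (tail a ⊛ b) (suc n)                          ≡⟨ cong (λ z → a 0 ℤ.* b (suc (suc n)) ℤ.+ z) (⊛-suc′ (tail a) b n) ⟩
  a 0 ℤ.* b (suc (suc n)) ℤ.+ ((tail a ⊛ tail b) n ℤ.+ a (suc (suc n)) ℤ.* b 0) ≡⟨ ℤₚ.+-assoc (a 0 ℤ.* b (suc (suc n))) ((tail a ⊛ tail b) n) (a (suc (suc n)) ℤ.* b 0) ⟨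
  a 0 ℤ.* b (suc (suc n)) ℤ.+ (tail a ⊛ tail b) n ℤ.+ a (suc (suc n)) ℤ.* b 0  ≡⟨ cong (ℤ._+ (a (suc (suc n)) ℤ.* b 0)) (⊛-suc a (tail b) n) ⟨
  (a ⊛ tail b) (suc n) ℤ.+ a (suc (suc n)) ℤ.* b 0                             ∎
  where open ≡.≡-Reasoning

⊛-local : ∀ n {a a′ b b′} → (∀ k → k ≤ n → a k ≡ a′ k) → (∀ k → k ≤ n → b k ≡ b′ k) →
          (a ⊛ b) n ≡ (a′ ⊛ b′) n
⊛-local n a≡a′ b≡b′ = Σ≤-cong n (λ k k≤n → cong₂ ℤ._*_ (a≡a′ k k≤n) (b≡b′ (n ∸ k) (ℕₚ.m∸n≤m n k)))

⊛-comm : ∀ a b n → (a ⊛ b) n ≡ (b ⊛ a) n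
⊛-comm a b zero = begin
  (a ⊛ b) 0    ≡⟨ ⊛-zero a b ⟩
  a 0 ℤ.* b 0  ≡⟨ ℤₚ.*-comm (a 0) (b 0) ⟩
  b 0 ℤ.* a 0  ≡⟨ ⊛-zero b a ⟨
  (b ⊛ a) 0    ∎
  where open ≡.≡-Reasoning
⊛-comm a b (suc n) = begin
  (a ⊛ b) (suc n)                            ≡⟨ ⊛-suc a b n ⟩
  a 0 ℤ.* b (suc n) ℤ.+ (tail a ⊛ b) n       ≡⟨ cong₂ ℤ._+_ (ℤₚ.*-comm (a 0) _) (⊛-comm (tail a) b n) ⟩
  b (suc n) ℤ.* a 0 ℤ.+ (b ⊛ tail a) n       ≡⟨ ℤₚ.+-comm _ ((b ⊛ tail a) n) ⟩
  (b ⊛ tail a) n ℤ.+ b (suc n) ℤ.* a 0       ≡⟨ ⊛-suc′ b a n ⟨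
  (b ⊛ a) (suc n)                            ∎
  where open ≡.≡-Reasoning

⊛-distribʳ : ∀ c a b n → ((a ⊕ b) ⊛ c) n ≡ (a ⊛ c) n ℤ.+ (b ⊛ c) n
⊛-distribʳ c a b zero = begin
  ((a ⊕ b) ⊛ c) 0                  ≡⟨ ⊛-zero (a ⊕ b) c ⟩
  (a 0 ℤ.+ b 0) ℤ.* c 0            ≡⟨ ℤₚ.*-distribʳ-+ (c 0) (a 0) (b 0) ⟩
  a 0 ℤ.* c 0 ℤ.+ b 0 ℤ.* c 0      ≡⟨ cong₂ ℤ._+_ (⊛-zero a c) (⊛-zero b c) ⟨
  (a ⊛ c) 0 ℤ.+ (b ⊛ c) 0          ∎
  where open ≡.≡-Reasoning
⊛-distribʳ c a b (suc n) = begin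
  ((a ⊕ b) ⊛ c) (suc n)                                         ≡⟨ ⊛-suc (a ⊕ b) c n ⟩
  (a 0 ℤ.+ b 0) ℤ.* c (suc n) ℤ.+ ((tail a ⊕ tail b) ⊛ c) n     ≡⟨ cong (ℤ._+_ ((a 0 ℤ.+ b 0) ℤ.* c (suc n))) (⊛-distribʳ c (tail a) (tail b) n) ⟩
  (a 0 ℤ.+ b 0) ℤ.* c (suc n) ℤ.+ ((tail a ⊛ c) n ℤ.+ (tail b ⊛ c) n)
    ≡⟨ rearrange (a 0) (b 0) (c (suc n)) ((tail a ⊛ c) n) ((tail b ⊛ c) n) ⟩
  (a 0 ℤ.* c (suc n) ℤ.+ (tail a ⊛ c) n) ℤ.+ (b 0 ℤ.* c (suc n) ℤ.+ (tail b ⊛ c) n)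
    ≡⟨ cong₂ ℤ._+_ (⊛-suc a c n) (⊛-suc b c n) ⟨
  (a ⊛ c) (suc n) ℤ.+ (b ⊛ c) (suc n)                           ∎
  where
  open ≡.≡-Reasoning
  rearrange : ∀ x y z u v → (x ℤ.+ y) ℤ.* z ℤ.+ (u ℤ.+ v) ≡ (x ℤ.* z ℤ.+ u) ℤ.+ (y ℤ.* z ℤ.+ v)
  rearrange = ℤSolver.solve-∀

scale-⊛ : ∀ z a b n → ((λ k → z ℤ.* a k) ⊛ b) n ≡ z ℤ.* (a ⊛ b) n
scale-⊛ z a b zero = begin
  ((λ k → z ℤ.* a k) ⊛ b) 0   ≡⟨ ⊛-zero (λ k → z ℤ.* a k) b ⟩
  z ℤ.* a 0 ℤ.* b 0           ≡⟨ ℤₚ.*-assoc z (a 0) (b 0) ⟩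
  z ℤ.* (a 0 ℤ.* b 0)         ≡⟨ cong (z ℤ.*_) (⊛-zero a b) ⟨
  z ℤ.* (a ⊛ b) 0             ∎
  where open ≡.≡-Reasoning
scale-⊛ z a b (suc n) = begin
  ((λ k → z ℤ.* a k) ⊛ b) (suc n)                                      ≡⟨ ⊛-suc (λ k → z ℤ.* a k) b n ⟩
  z ℤ.* a 0 ℤ.* b (suc n) ℤ.+ ((λ k → z ℤ.* tail a k) ⊛ b) n           ≡⟨ cong₂ ℤ._+_ (ℤₚ.*-assoc z (a 0) _) (scale-⊛ z (tail a) b n) ⟩
  z ℤ.* (a 0 ℤ.* b (suc n)) ℤ.+ z ℤ.* (tail a ⊛ b) n                   ≡⟨ ℤₚ.*-distribˡ-+ z _ _ ⟨
  z ℤ.* (a 0 ℤ.* b (suc n) ℤ.+ (tail a ⊛ b) n)                         ≡⟨ cong (z ℤ.*_) (⊛-suc a b n) ⟨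
  z ℤ.* (a ⊛ b) (suc n)                                                ∎
  where open ≡.≡-Reasoning

⊛-assoc : ∀ a b c n → ((a ⊛ b) ⊛ c) n ≡ (a ⊛ (b ⊛ c)) n
⊛-assoc a b c zero = begin
  ((a ⊛ b) ⊛ c) 0              ≡⟨ ⊛-zero (a ⊛ b) c ⟩
  (a ⊛ b) 0 ℤ.* c 0            ≡⟨ cong (ℤ._* c 0) (⊛-zero a b) ⟩
  a 0 ℤ.* b 0 ℤ.* c 0          ≡⟨ ℤₚ.*-assoc (a 0) (b 0) (c 0) ⟩
  a 0 ℤ.* (b 0 ℤ.* c 0)        ≡⟨ cong (a 0 ℤ.*_) (⊛-zero b c) ⟨
  a 0 ℤ.* (b ⊛ c) 0            ≡⟨ ⊛-zero a (b ⊛ c) ⟨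
  (a ⊛ (b ⊛ c)) 0              ∎
  where open ≡.≡-Reasoning
⊛-assoc a b c (suc n) = begin
  ((a ⊛ b) ⊛ c) (suc n)
    ≡⟨ ⊛-suc (a ⊛ b) c n ⟩
  (a ⊛ b) 0 ℤ.* c (suc n) ℤ.+ (tail (a ⊛ b) ⊛ c) n
    ≡⟨ cong₂ ℤ._+_ (cong (ℤ._* c (suc n)) (⊛-zero a b)) (⊛-local n {b = c} (λ k _ → ⊛-suc a b k) (λ _ _ → ≡.refl)) ⟩
  a 0 ℤ.* b 0 ℤ.* c (suc n) ℤ.+ (((λ k → a 0 ℤ.* tail b k) ⊕ (tail a ⊛ b)) ⊛ c) n
    ≡⟨ cong (λ z → a 0 ℤ.* b 0 ℤ.* c (suc n) ℤ.+ z) (⊛-distribʳ c (λ k → a 0 ℤ.* tail b k) (tail a ⊛ b) n) ⟩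
  a 0 ℤ.* b 0 ℤ.* c (suc n) ℤ.+ (((λ k → a 0 ℤ.* tail b k) ⊛ c) n ℤ.+ ((tail a ⊛ b) ⊛ c) n)
    ≡⟨ cong (λ z → a 0 ℤ.* b 0 ℤ.* c (suc n) ℤ.+ z) (cong₂ ℤ._+_ (scale-⊛ (a 0) (tail b) c n) (⊛-assoc (tail a) b c n)) ⟩
  a 0 ℤ.* b 0 ℤ.* c (suc n) ℤ.+ (a 0 ℤ.* (tail b ⊛ c) n ℤ.+ (tail a ⊛ (b ⊛ c)) n)
    ≡⟨ rearrange (a 0) (b 0) (c (suc n)) ((tail b ⊛ c) n) ((tail a ⊛ (b ⊛ c)) n) ⟩
  a 0 ℤ.* (b 0 ℤ.* c (suc n) ℤ.+ (tail b ⊛ c) n) ℤ.+ (tail a ⊛ (b ⊛ c)) n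
    ≡⟨ cong (λ z → a 0 ℤ.* z ℤ.+ (tail a ⊛ (b ⊛ c)) n) (⊛-suc b c n) ⟨
  a 0 ℤ.* (b ⊛ c) (suc n) ℤ.+ (tail a ⊛ (b ⊛ c)) n
    ≡⟨ ⊛-suc a (b ⊛ c) n ⟨
  (a ⊛ (b ⊛ c)) (suc n) ∎
  where
  open ≡.≡-Reasoning
  rearrange : ∀ x y z u v → x ℤ.* y ℤ.* z ℤ.+ (x ℤ.* u ℤ.+ v) ≡ x ℤ.* (y ℤ.* z ℤ.+ u) ℤ.+ v
  rearrange = ℤSolver.solve-∀

zeroS-⊛ : ∀ a n → (zeroS ⊛ a) n ≡ + 0
zeroS-⊛ a n = Σ≤-zero n _ (λ _ _ → ≡.refl)

oneS-⊛ : ∀ a n → (oneS ⊛ a) n ≡ a n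
oneS-⊛ a zero = ≡.trans (⊛-zero oneS a) (ℤₚ.*-identityˡ (a 0))
oneS-⊛ a (suc n) = begin
  (oneS ⊛ a) (suc n)                       ≡⟨ ⊛-suc oneS a n ⟩
  + 1 ℤ.* a (suc n) ℤ.+ (zeroS ⊛ a) n      ≡⟨ cong₂ ℤ._+_ (ℤₚ.*-identityˡ (a (suc n))) (zeroS-⊛ a n) ⟩
  a (suc n) ℤ.+ + 0                        ≡⟨ ℤₚ.+-identityʳ _ ⟩
  a (suc n)                                ∎
  where open ≡.≡-Reasoning

everywhere : ∀ {n a b} → (∀ k → a k ≡ b k) → a ≈[ n ] b
everywhere a≡b = agree (λ k _ → a≡b k)

-- By `⊛-local` a coefficient of a product depends only on coefficients of no larger index, so
-- agreement up to `n` is a congruence.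
truncatedRing : ℕ → CommutativeRing 0ℓ 0ℓ
truncatedRing n = record
  { Carrier = Series
  ; _≈_ = _≈[ n ]_
  ; _+_ = _⊕_
  ; _*_ = _⊛_
  ; -_ = ⊖_
  ; 0# = zeroS
  ; 1# = oneS
  ; isCommutativeRing = record
    { isRing = record
      { +-isAbelianGroup = record
        { isGroup = record
          { isMonoid = record
            { isSemigroup = record
              { isMagma = record
                { isEquivalence = record
                  { refl = everywhere (λ _ → ≡.refl)
                  ; sym = λ p → agree (λ k k≤n → ≡.sym (coeff p k k≤n))
                  ; trans = λ p r → agree (λ k k≤n → ≡.trans (coeff p k k≤n) (coeff r k k≤n)) }
                ; ∙-cong = λ p r → agree (λ k k≤n → cong₂ ℤ._+_ (coeff p k k≤n) (coeff r k k≤n)) }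
              ; assoc = λ a b c → everywhere (λ k → ℤₚ.+-assoc (a k) (b k) (c k)) }
            ; identity = (λ a → everywhere (λ k → ℤₚ.+-identityˡ (a k)))
                       , (λ a → everywhere (λ k → ℤₚ.+-identityʳ (a k))) }
          ; inverse = (λ a → everywhere (λ k → ℤₚ.+-inverseˡ (a k)))
                    , (λ a → everywhere (λ k → ℤₚ.+-inverseʳ (a k)))
          ; ⁻¹-cong = λ p → agree (λ k k≤n → cong ℤ.-_ (coeff p k k≤n)) }
        ; comm = λ a b → everywhere (λ k → ℤₚ.+-comm (a k) (b k)) }
      ; *-cong = λ p r → agree (λ k k≤n → ⊛-local k (λ j j≤k → coeff p j (ℕₚ.≤-trans j≤k k≤n))
                                                    (λ j j≤k → coeff r j (ℕₚ.≤-trans j≤k k≤n)))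
      ; *-assoc = λ a b c → everywhere (⊛-assoc a b c)
      ; *-identity = (λ a → everywhere (oneS-⊛ a))
                   , (λ a → everywhere (λ k → ≡.trans (⊛-comm a oneS k) (oneS-⊛ a k)))
      ; distrib = (λ c a b → everywhere (λ k → ≡.trans (⊛-comm c (a ⊕ b) k)
                    (≡.trans (⊛-distribʳ c a b k) (cong₂ ℤ._+_ (⊛-comm a c k) (⊛-comm b c k)))))
                , (λ c a b → everywhere (⊛-distribʳ c a b)) }
    ; *-comm = λ a b → everywhere (⊛-comm a b) } }

-- Monomials and geometric series

mono-zero : ∀ m n → n < m → mono m n ≡ + 0
mono-zero (suc m) zero _ = ≡.refl
mono-zero (suc m) (suc n) (s≤s n<m) = mono-zero m n n<m

mono-⊛-< : ∀ m a n → n < m → (mono m ⊛ a) n ≡ + 0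
mono-⊛-< (suc m) a zero _ = ≡.refl
mono-⊛-< (suc m) a (suc n) (s≤s n<m) = ≡.trans (⊛-suc (mono (suc m)) a n)
  (≡.trans (ℤₚ.+-identityˡ _) (mono-⊛-< m a n n<m))

mono-⊛-+ : ∀ m a n → (mono m ⊛ a) (m ℕ.+ n) ≡ a n
mono-⊛-+ zero a n = oneS-⊛ a n
mono-⊛-+ (suc m) a n = ≡.trans (⊛-suc (mono (suc m)) a (m ℕ.+ n))
  (≡.trans (ℤₚ.+-identityˡ _) (mono-⊛-+ m a n))

mono-+ : ∀ i j n → mono (i ℕ.+ j) n ≡ (mono i ⊛ mono j) n
mono-+ zero j n = ≡.sym (oneS-⊛ (mono j) n)
mono-+ (suc i) j zero = ≡.refl
mono-+ (suc i) j (suc n) = ≡.trans (mono-+ i j n)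
  (≡.sym (≡.trans (⊛-suc (mono (suc i)) (mono j) n) (ℤₚ.+-identityˡ _)))

≢⇒[≡ᵇ]≡0 : ∀ m n → m ≢ n → [ m ≡ᵇ n ] ≡ + 0
≢⇒[≡ᵇ]≡0 zero zero m≢n = contradiction ≡.refl m≢n
≢⇒[≡ᵇ]≡0 zero (suc n) m≢n = ≡.refl
≢⇒[≡ᵇ]≡0 (suc m) zero m≢n = ≡.refl
≢⇒[≡ᵇ]≡0 (suc m) (suc n) m≢n = ≢⇒[≡ᵇ]≡0 m n (m≢n ∘ cong suc)

≡ᵇ-+ : ∀ k m n → (k ℕ.+ m ≡ᵇ k ℕ.+ n) ≡ (m ≡ᵇ n)
≡ᵇ-+ zero m n = ≡.refl
≡ᵇ-+ (suc k) m n = ≡ᵇ-+ k m n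

≡ᵇ-sym : ∀ m n → (m ≡ᵇ n) ≡ (n ≡ᵇ m)
≡ᵇ-sym zero zero = ≡.refl
≡ᵇ-sym zero (suc n) = ≡.refl
≡ᵇ-sym (suc m) zero = ≡.refl
≡ᵇ-sym (suc m) (suc n) = ≡ᵇ-sym m n

Σ≤-extend : ∀ d n g → (∀ k → n < k → g k ≡ + 0) → Σ≤ (d ℕ.+ n) g ≡ Σ≤ n g
Σ≤-extend zero zero g _ = ≡.refl
Σ≤-extend (suc d) zero g g≡0 = ≡.trans (Σ≤-suc (d ℕ.+ 0) g)
  (cong (λ z → g 0 ℤ.+ z) (Σ≤-zero (d ℕ.+ 0) (g ∘ suc) (λ k _ → g≡0 (suc k) (s≤s z≤n))))
Σ≤-extend d (suc n) g g≡0 = begin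
  Σ≤ (d ℕ.+ suc n) g              ≡⟨ cong (λ k → Σ≤ k g) (ℕₚ.+-suc d n) ⟩
  Σ≤ (suc (d ℕ.+ n)) g            ≡⟨ Σ≤-suc (d ℕ.+ n) g ⟩
  g 0 ℤ.+ Σ≤ (d ℕ.+ n) (g ∘ suc)  ≡⟨ cong (λ z → g 0 ℤ.+ z) (Σ≤-extend d n (g ∘ suc) (λ k n<k → g≡0 (suc k) (s≤s n<k))) ⟩
  g 0 ℤ.+ Σ≤ n (g ∘ suc)          ≡⟨ Σ≤-suc n g ⟨
  Σ≤ (suc n) g                    ∎
  where open ≡.≡-Reasoning

-- The series Σ c(k) q^(mk), common to both geometric series. For m ≥ 1 stopping at k = n loses
-- nothing, since mk ≥ k.
sparse : ℕ → (ℕ → ℤ) → Series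
sparse m c n = Σ≤ n (λ k → c k ℤ.* [ m ℕ.* k ≡ᵇ n ])

sparse-unfold : ∀ m c n → sparse (suc m) c n ≡ c 0 ℤ.* oneS n ℤ.+ (mono (suc m) ⊛ sparse (suc m) (c ∘ suc)) n
sparse-unfold m c zero = cong (λ z → c 0 ℤ.* [ z ≡ᵇ 0 ] ℤ.+ + 0) (ℕₚ.*-zeroʳ (suc m))
sparse-unfold m c (suc n) = begin
  sparse (suc m) c (suc n)
    ≡⟨ Σ≤-suc n (λ k → c k ℤ.* [ suc m ℕ.* k ≡ᵇ suc n ]) ⟩
  c 0 ℤ.* [ suc m ℕ.* 0 ≡ᵇ suc n ] ℤ.+ Σ≤ n rest
    ≡⟨ cong₂ (λ z w → c 0 ℤ.* [ z ≡ᵇ suc n ] ℤ.+ w) (ℕₚ.*-zeroʳ (suc m)) (go (ℕₚ.≤-<-connex (suc m) (suc n))) ⟩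
  c 0 ℤ.* + 0 ℤ.+ (mono (suc m) ⊛ sparse (suc m) (c ∘ suc)) (suc n) ∎
  where
  open ≡.≡-Reasoning
  rest : ℕ → ℤ
  rest k = c (suc k) ℤ.* [ suc m ℕ.* suc k ≡ᵇ suc n ]

  go : suc m ≤ suc n ⊎ suc n < suc m → Σ≤ n rest ≡ (mono (suc m) ⊛ sparse (suc m) (c ∘ suc)) (suc n)
  go (inj₁ (s≤s m≤n)) = begin
    Σ≤ n rest
      ≡⟨ Σ≤-cong n (λ k _ → cong (λ B → c (suc k) ℤ.* [ B ]) (cancel k)) ⟩
    Σ≤ n (λ k → c (suc k) ℤ.* [ suc m ℕ.* k ≡ᵇ j ])
      ≡⟨ cong (λ N → Σ≤ N (λ k → c (suc k) ℤ.* [ suc m ℕ.* k ≡ᵇ j ])) n≡ ⟨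
    Σ≤ (m ℕ.+ j) (λ k → c (suc k) ℤ.* [ suc m ℕ.* k ≡ᵇ j ])
      -- The bound drops from `n` to `j = n ∸ m`: for `k > j` already `suc m * k ≥ k > j`.
      ≡⟨ Σ≤-extend m j _ (λ k j<k → ≡.trans
           (cong (c (suc k) ℤ.*_) (≢⇒[≡ᵇ]≡0 _ j (ℕₚ.>⇒≢ (ℕₚ.<-≤-trans j<k (ℕₚ.m≤n*m k (suc m))))))
           (ℤₚ.*-zeroʳ (c (suc k)))) ⟩
    sparse (suc m) (c ∘ suc) j
      ≡⟨ mono-⊛-+ (suc m) (sparse (suc m) (c ∘ suc)) j ⟨
    (mono (suc m) ⊛ sparse (suc m) (c ∘ suc)) (suc m ℕ.+ j)
      ≡⟨ cong (λ N → (mono (suc m) ⊛ sparse (suc m) (c ∘ suc)) (suc N)) n≡ ⟩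
    (mono (suc m) ⊛ sparse (suc m) (c ∘ suc)) (suc n) ∎
    where
    j = n ∸ m
    n≡ : m ℕ.+ j ≡ n
    n≡ = ℕₚ.m+[n∸m]≡n m≤n
    cancel : ∀ k → (suc m ℕ.* suc k ≡ᵇ suc n) ≡ (suc m ℕ.* k ≡ᵇ j)
    cancel k = ≡.trans (cong₂ _≡ᵇ_ (ℕₚ.*-suc (suc m) k) (cong suc (≡.sym n≡))) (≡ᵇ-+ (suc m) (suc m ℕ.* k) j)
  go (inj₂ n<m) = ≡.trans
    (Σ≤-zero n rest (λ k _ → ≡.trans
      (cong (c (suc k) ℤ.*_) (≢⇒[≡ᵇ]≡0 (suc m ℕ.* suc k) (suc n) (ℕₚ.>⇒≢ (ℕₚ.<-≤-trans n<m (ℕₚ.m≤m*n (suc m) (suc k))))))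
      (ℤₚ.*-zeroʳ (c (suc k)))))
    (≡.sym (mono-⊛-< (suc m) (sparse (suc m) (c ∘ suc)) (suc n) n<m))

invOneMinus-unfold : ∀ m n → invOneMinus (suc m) n ≡ (oneS ⊕ (mono (suc m) ⊛ invOneMinus (suc m))) n
invOneMinus-unfold m n = begin
  invOneMinus (suc m) n                                                  ≡⟨ to-sparse n ⟩
  sparse (suc m) (λ _ → + 1) n                                           ≡⟨ sparse-unfold m (λ _ → + 1) n ⟩
  + 1 ℤ.* oneS n ℤ.+ (mono (suc m) ⊛ sparse (suc m) (λ _ → + 1)) n
    ≡⟨ cong₂ ℤ._+_ (ℤₚ.*-identityˡ (oneS n)) (⊛-local n {a = mono (suc m)} (λ _ _ → ≡.refl) (λ k _ → ≡.sym (to-sparse k))) ⟩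
  (oneS ⊕ (mono (suc m) ⊛ invOneMinus (suc m))) n                        ∎
  where
  open ≡.≡-Reasoning
  to-sparse : ∀ n → invOneMinus (suc m) n ≡ sparse (suc m) (λ _ → + 1) n
  to-sparse n = Σ≤-cong n (λ k _ → ≡.sym (ℤₚ.*-identityˡ [ suc m ℕ.* k ≡ᵇ n ]))

Σ≤-neg : ∀ n g → Σ≤ n (λ k → ℤ.- g k) ≡ ℤ.- Σ≤ n g
Σ≤-neg zero g = ≡.sym (ℤₚ.neg-distrib-+ (g 0) (+ 0))
Σ≤-neg (suc n) g = begin
  Σ≤ (suc n) (λ k → ℤ.- g k)              ≡⟨ Σ≤-suc n (λ k → ℤ.- g k) ⟩
  ℤ.- g 0 ℤ.+ Σ≤ n (λ k → ℤ.- g (suc k))  ≡⟨ cong (λ z → ℤ.- g 0 ℤ.+ z) (Σ≤-neg n (g ∘ suc)) ⟩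
  ℤ.- g 0 ℤ.+ ℤ.- Σ≤ n (g ∘ suc)          ≡⟨ ℤₚ.neg-distrib-+ (g 0) (Σ≤ n (g ∘ suc)) ⟨
  ℤ.- (g 0 ℤ.+ Σ≤ n (g ∘ suc))            ≡⟨ cong ℤ.-_ (Σ≤-suc n g) ⟨
  ℤ.- Σ≤ (suc n) g                        ∎
  where open ≡.≡-Reasoning

invOnePlus-unfold : ∀ m n → invOnePlus (suc m) n ≡ (oneS ⊕ (mono (suc m) ⊛ (⊖ invOnePlus (suc m)))) n
invOnePlus-unfold m n = begin
  sparse (suc m) signPow n
    ≡⟨ sparse-unfold m signPow n ⟩
  + 1 ℤ.* oneS n ℤ.+ (mono (suc m) ⊛ sparse (suc m) (signPow ∘ suc)) n
    ≡⟨ cong₂ ℤ._+_ (ℤₚ.*-identityˡ (oneS n)) (⊛-local n {a = mono (suc m)} (λ _ _ → ≡.refl) (λ k _ → negate k)) ⟩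
  (oneS ⊕ (mono (suc m) ⊛ (⊖ invOnePlus (suc m)))) n ∎
  where
  open ≡.≡-Reasoning
  negate : ∀ n → sparse (suc m) (signPow ∘ suc) n ≡ ℤ.- invOnePlus (suc m) n
  negate n = ≡.trans (Σ≤-cong n (λ k _ → ≡.sym (ℤₚ.neg-distribˡ-* (signPow k) [ suc m ℕ.* k ≡ᵇ n ])))
    (Σ≤-neg n (λ k → signPow k ℤ.* [ suc m ℕ.* k ≡ᵇ n ]))

-- Even hooks and β-numbers

parity : ℕ → Bool
parity zero = true
parity (suc k) = not (parity k)

tick : Bool → Bool → ℕ
tick true  true  = 1
tick true  false = 0
tick false true  = 0
tick false false = 1

-- The number of β-numbers cⱼ + (L − j) of parity e, the list c being padded
-- with zeros to length L.
count : Bool → ℕ → List ℕ → ℕ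
count e zero    c       = 0
count e (suc L) []      = tick (parity L) e ℕ.+ count e L []
count e (suc L) (x ∷ c) = tick (parity (x ℕ.+ L)) e ℕ.+ count e L c

-- Lists that fit into a box of `L` rows and `b` columns; each entry becomes the bound for the next,
-- which forces weak decrease.
data Bounded : ℕ → ℕ → List ℕ → Set where
  []  : ∀ {b L} → Bounded b L []
  _∷_ : ∀ {b L x c} → x ≤ b → Bounded x L c → Bounded b (suc L) (x ∷ c)

parity-double : ∀ k → parity (k ℕ.+ k) ≡ true
parity-double zero = ≡.refl
parity-double (suc k) rewrite ℕₚ.+-suc k k | parity-double k = ≡.refl

tick-true : ∀ L → tick (parity L) true ℕ.+ ⌈ L /2⌉ ≡ ⌈ suc L /2⌉
tick-true zero = ≡.refl
tick-true (suc zero) = ≡.refl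
tick-true (suc (suc L)) with parity L | tick-true L
... | true  | eq = cong suc eq
... | false | eq = cong suc eq

tick-false : ∀ L → tick (parity L) false ℕ.+ ⌊ L /2⌋ ≡ ⌊ suc L /2⌋
tick-false zero = ≡.refl
tick-false (suc zero) = ≡.refl
tick-false (suc (suc L)) with parity L | tick-false L
... | true  | eq = cong suc eq
... | false | eq = cong suc eq

-- Without parts the β-numbers are 0, ..., L - 1.
count-true-[] : ∀ L → count true L [] ≡ ⌈ L /2⌉
count-true-[] zero = ≡.refl
count-true-[] (suc L) = ≡.trans (cong (tick (parity L) true ℕ.+_) (count-true-[] L)) (tick-true L)

count-false-[] : ∀ L → count false L [] ≡ ⌊ L /2⌋
count-false-[] zero = ≡.refl
count-false-[] (suc L) = ≡.trans (cong (tick (parity L) false ℕ.+_) (count-false-[] L)) (tick-false L)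

evenᵇ≡parity : ∀ k → evenᵇ k ≡ parity k
evenᵇ≡parity zero = ≡.refl
evenᵇ≡parity (suc zero) = ≡.refl
evenᵇ≡parity (suc (suc k)) = ≡.trans (evenᵇ≡parity k) (≡.sym (not-involutive (parity k)))

-- Counting even hooks row by row

#filter : ∀ {A : Set} → (A → Bool) → List A → ℕ
#filter P xs = length (filter (λ x → P x Bool.≟ true) xs)

#filter-++ : ∀ {A : Set} (P : A → Bool) xs ys → #filter P (xs ++ ys) ≡ #filter P xs ℕ.+ #filter P ys
#filter-++ P xs ys = ≡.trans (cong length (filter-++ (λ x → P x Bool.≟ true) xs ys)) (length-++ (filter _ xs))

#filter-single : ∀ {A : Set} (P : A → Bool) x → #filter P (x ∷ []) ≡ tick (P x) true
#filter-single P x with P x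
... | true  = ≡.refl
... | false = ≡.refl

#upTo : (ℕ → Bool) → ℕ → ℕ
#upTo P zero = 0
#upTo P (suc k) = #upTo P k ℕ.+ tick (P (suc k)) true

#upTo-cong : ∀ {P Q} k → (∀ j → j ≤ k → P j ≡ Q j) → #upTo P k ≡ #upTo Q k
#upTo-cong zero _ = ≡.refl
#upTo-cong (suc k) P≡Q = cong₂ ℕ._+_ (#upTo-cong k (λ j j≤k → P≡Q j (ℕₚ.m≤n⇒m≤1+n j≤k)))
                                  (cong (λ B → tick B true) (P≡Q (suc k) ℕₚ.≤-refl))

#filter-row : ∀ {A : Set} (P : A → Bool) (h : ℕ → A) k → #filter P (map h (applyUpTo suc k)) ≡ #upTo (P ∘ h) k
#filter-row P h zero = ≡.refl
#filter-row P h (suc k) = begin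
  #filter P (map h (applyUpTo suc (suc k)))                ≡⟨ cong (#filter P ∘ map h) (applyUpTo-∷ʳ suc k) ⟨
  #filter P (map h (applyUpTo suc k ∷ʳ suc k))             ≡⟨ cong (#filter P) (map-++ h (applyUpTo suc k) _) ⟩
  #filter P (map h (applyUpTo suc k) ++ h (suc k) ∷ [])    ≡⟨ #filter-++ P (map h (applyUpTo suc k)) _ ⟩
  #filter P (map h (applyUpTo suc k)) ℕ.+ #filter P (h (suc k) ∷ [])
                                                           ≡⟨ cong₂ ℕ._+_ (#filter-row P h k) (#filter-single P (h (suc k))) ⟩
  #upTo (P ∘ h) (suc k)                                    ∎
  where open ≡.≡-Reasoning

#filter-concatMap-cong : ∀ {A B : Set} (P Q : A → Bool) (F G : B → List A) (u v : ℕ → B) l →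
  (∀ i → #filter P (F (u i)) ≡ #filter Q (G (v i))) →
  #filter P (concatMap F (applyUpTo u l)) ≡ #filter Q (concatMap G (applyUpTo v l))
#filter-concatMap-cong P Q F G u v zero _ = ≡.refl
#filter-concatMap-cong P Q F G u v (suc l) rows = begin
  #filter P (F (u 0) ++ concatMap F (applyUpTo (u ∘ suc) l))           ≡⟨ #filter-++ P (F (u 0)) _ ⟩
  #filter P (F (u 0)) ℕ.+ #filter P (concatMap F (applyUpTo (u ∘ suc) l))
    ≡⟨ cong₂ ℕ._+_ (rows 0) (#filter-concatMap-cong P Q F G (u ∘ suc) (v ∘ suc) l (rows ∘ suc)) ⟩
  #filter Q (G (v 0)) ℕ.+ #filter Q (concatMap G (applyUpTo (v ∘ suc) l)) ≡⟨ #filter-++ Q (G (v 0)) _ ⟨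
  #filter Q (G (v 0) ++ concatMap G (applyUpTo (v ∘ suc) l))           ∎
  where open ≡.≡-Reasoning

conj-∷ : ∀ x c j → j ≤ x → conj (x ∷ c) j ≡ suc (conj c j)
conj-∷ x c j j≤x = cong length (filter-accept (λ y → y ℕₚ.≥? j) {x} {c} j≤x)

conj-large : ∀ {x L c} j → x < j → Bounded x L c → conj c j ≡ 0
conj-large j x<j [] = ≡.refl
conj-large {c = y ∷ c} j x<j (y≤x ∷ bounded) = ≡.trans
  (cong length (filter-reject (λ z → z ℕₚ.≥? j) {y} {c} (ℕₚ.<⇒≱ y<j)))
  (conj-large j y<j bounded)
  where
  y<j = ℕₚ.≤-<-trans y≤x x<j

part-bounded : ∀ {x L c} i → Bounded x L c → part c (suc i) ≤ x
part-bounded i [] = z≤n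
part-bounded zero (y≤x ∷ bounded) = y≤x
part-bounded (suc i) (y≤x ∷ bounded) = ℕₚ.≤-trans (part-bounded i bounded) y≤x

-- The even and the odd hooks in a first row x placed on top of c; the hook
-- length at column j is suc (x ∸ j + conj c j).
rowEven rowOdd : ℕ → List ℕ → ℕ
rowEven x c = #upTo (λ j → parity (suc (x ∸ j ℕ.+ conj c j))) x
rowOdd x c = #upTo (λ j → parity (x ∸ j ℕ.+ conj c j)) x

-- For a cell of `c`, the new top row raises the column length and the row index by one each, so its
-- hook is unchanged. Boundedness ensures that `x` covers every column of `c`.
evenHooks-∷ : ∀ {x L c} → Bounded x L c → evenHooks (x ∷ c) ≡ rowEven x c ℕ.+ evenHooks c
evenHooks-∷ {x} {L} {c} bounded = begin
  #filter P (row 1 ++ concatMap row (applyUpTo (suc ∘ suc) (length c)))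
    ≡⟨ #filter-++ P (row 1) _ ⟩
  #filter P (row 1) ℕ.+ #filter P (concatMap row (applyUpTo (suc ∘ suc) (length c)))
    ≡⟨ cong₂ ℕ._+_ (≡.trans (#filter-row P (λ j → 1 , j) x) (#upTo-cong x first))
         (#filter-concatMap-cong P Q row row′ (suc ∘ suc) suc (length c) rest) ⟩
  rowEven x c ℕ.+ evenHooks c ∎
  where
  open ≡.≡-Reasoning
  P Q : ℕ × ℕ → Bool
  P (i , j) = evenᵇ (hook (x ∷ c) i j)
  Q (i , j) = evenᵇ (hook c i j)

  row row′ : ℕ → List (ℕ × ℕ)
  row i = map (λ j → i , j) (applyUpTo suc (part (x ∷ c) i))
  row′ i = map (λ j → i , j) (applyUpTo suc (part c i))

  first : ∀ j → j ≤ x → P (1 , j) ≡ parity (suc (x ∸ j ℕ.+ conj c j))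
  first j j≤x = begin
    evenᵇ (x ∸ j ℕ.+ conj (x ∷ c) j ∸ 1 ℕ.+ 1)  ≡⟨ cong (λ z → evenᵇ (x ∸ j ℕ.+ z ∸ 1 ℕ.+ 1)) (conj-∷ x c j j≤x) ⟩
    evenᵇ (x ∸ j ℕ.+ suc (conj c j) ∸ 1 ℕ.+ 1)  ≡⟨ cong (λ z → evenᵇ (z ∸ 1 ℕ.+ 1)) (ℕₚ.+-suc (x ∸ j) (conj c j)) ⟩
    evenᵇ (x ∸ j ℕ.+ conj c j ℕ.+ 1)            ≡⟨ cong evenᵇ (ℕₚ.+-comm (x ∸ j ℕ.+ conj c j) 1) ⟩
    evenᵇ (suc (x ∸ j ℕ.+ conj c j))            ≡⟨ evenᵇ≡parity (suc (x ∸ j ℕ.+ conj c j)) ⟩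
    parity (suc (x ∸ j ℕ.+ conj c j))           ∎

  shift : ∀ i j → j ≤ part c (suc i) → P (suc (suc i) , j) ≡ Q (suc i , j)
  shift i j j≤ = begin
    evenᵇ (part c (suc i) ∸ j ℕ.+ conj (x ∷ c) j ∸ suc (suc i) ℕ.+ 1)
      ≡⟨ cong (λ z → evenᵇ (part c (suc i) ∸ j ℕ.+ z ∸ suc (suc i) ℕ.+ 1)) (conj-∷ x c j (ℕₚ.≤-trans j≤ (part-bounded i bounded))) ⟩
    evenᵇ (part c (suc i) ∸ j ℕ.+ suc (conj c j) ∸ suc (suc i) ℕ.+ 1)
      ≡⟨ cong (λ z → evenᵇ (z ∸ suc (suc i) ℕ.+ 1)) (ℕₚ.+-suc (part c (suc i) ∸ j) (conj c j)) ⟩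
    evenᵇ (part c (suc i) ∸ j ℕ.+ conj c j ∸ suc i ℕ.+ 1) ∎

  rest : ∀ i → #filter P (row (suc (suc i))) ≡ #filter Q (row′ (suc i))
  rest i = begin
    #filter P (row (suc (suc i)))                              ≡⟨ #filter-row P (λ j → suc (suc i) , j) (part c (suc i)) ⟩
    #upTo (λ j → P (suc (suc i) , j)) (part c (suc i))         ≡⟨ #upTo-cong (part c (suc i)) (shift i) ⟩
    #upTo (λ j → Q (suc i , j)) (part c (suc i))               ≡⟨ #filter-row Q (λ j → suc i , j) (part c (suc i)) ⟨
    #filter Q (row′ (suc i))                                   ∎

-- The hook lengths in a first row x are the x + L − v with v < x + L not a
-- β-number of c; stated for both parities at once because lengthening the row
-- by one cell exchanges them.
RowCount : ℕ → ℕ → List ℕ → Set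
RowCount x L c =
  (rowEven x c ℕ.+ count (parity (x ℕ.+ L)) L c ≡ ⌊ x ℕ.+ L /2⌋) ×
  (rowOdd x c ℕ.+ count (not (parity (x ℕ.+ L))) L c ≡ ⌈ x ℕ.+ L /2⌉)

tick-same : ∀ B → tick B B ≡ 1
tick-same true = ≡.refl
tick-same false = ≡.refl

tick-not : ∀ B → tick B (not B) ≡ 0
tick-not true = ≡.refl
tick-not false = ≡.refl

rowCount-[] : ∀ L → RowCount 0 L []
rowCount-[] zero = ≡.refl , ≡.refl
rowCount-[] (suc L) =
  ≡.trans (cong (ℕ._+ count (not (parity L)) L []) (tick-not (parity L))) (proj₂ (rowCount-[] L)) ,
  (begin
    tick (parity L) (not (not (parity L))) ℕ.+ count (not (not (parity L))) L []
      ≡⟨ cong (λ B → tick (parity L) B ℕ.+ count B L []) (not-involutive (parity L)) ⟩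
    tick (parity L) (parity L) ℕ.+ count (parity L) L []
      ≡⟨ cong₂ ℕ._+_ (tick-same (parity L)) (proj₁ (rowCount-[] L)) ⟩
    suc ⌊ L /2⌋ ∎)
  where open ≡.≡-Reasoning

-- All old arms grow by one, which flips every parity, and the new last cell has hook length 1
-- because column `suc x` of `c` is empty. So the odd count becomes the even one, and the even count
-- plus one becomes the odd one.
rowCount-suc : ∀ {x L c} → Bounded x L c → RowCount x L c → RowCount (suc x) L c
rowCount-suc {x} {L} {c} bounded (even , odd) =
  ≡.trans (cong (ℕ._+ count (not (parity (x ℕ.+ L))) L c) rowEven-suc) odd ,
  ≡.trans (cong₂ ℕ._+_ rowOdd-suc (cong (λ B → count B L c) (not-involutive (parity (x ℕ.+ L))))) (cong suc even)
  where
  open ≡.≡-Reasoning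

  corner : x ∸ x ℕ.+ conj c (suc x) ≡ 0
  corner = cong₂ ℕ._+_ (ℕₚ.n∸n≡0 x) (conj-large (suc x) ℕₚ.≤-refl bounded)

  arm : ∀ j → j ≤ x → suc x ∸ j ℕ.+ conj c j ≡ suc (x ∸ j ℕ.+ conj c j)
  arm j j≤x = cong (ℕ._+ conj c j) (ℕₚ.+-∸-assoc 1 j≤x)

  rowEven-suc : rowEven (suc x) c ≡ rowOdd x c
  rowEven-suc = begin
    #upTo (λ j → parity (suc (suc x ∸ j ℕ.+ conj c j))) x ℕ.+ tick (parity (suc (x ∸ x ℕ.+ conj c (suc x)))) true
      ≡⟨ cong₂ ℕ._+_ (#upTo-cong x (λ j j≤x → ≡.trans (cong (parity ∘ suc) (arm j j≤x)) (not-involutive _)))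
                   (cong (λ z → tick (parity (suc z)) true) corner) ⟩
    rowOdd x c ℕ.+ 0  ≡⟨ ℕₚ.+-identityʳ _ ⟩
    rowOdd x c        ∎

  rowOdd-suc : rowOdd (suc x) c ≡ suc (rowEven x c)
  rowOdd-suc = begin
    #upTo (λ j → parity (suc x ∸ j ℕ.+ conj c j)) x ℕ.+ tick (parity (x ∸ x ℕ.+ conj c (suc x))) true
      ≡⟨ cong₂ ℕ._+_ (#upTo-cong x (λ j j≤x → cong parity (arm j j≤x)))
                   (cong (λ z → tick (parity z) true) corner) ⟩
    rowEven x c ℕ.+ 1   ≡⟨ ℕₚ.+-comm _ 1 ⟩
    suc (rowEven x c) ∎

-- A copy of the first row inserted below it lengthens every leg by one, which flips every parity.
-- The inserted β-number `y + L` is one less than that of the first row, so it is counted only in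
-- the second equation.
rowCount-∷ : ∀ {y L c} → RowCount y L c → RowCount y (suc L) (y ∷ c)
rowCount-∷ {y} {L} {c} (even , odd) =
  (begin
    rowEven y (y ∷ c) ℕ.+ count (parity (y ℕ.+ suc L)) (suc L) (y ∷ c)
      ≡⟨ cong₂ (λ r z → r ℕ.+ count (parity z) (suc L) (y ∷ c)) rowEven-∷ (ℕₚ.+-suc y L) ⟩
    rowOdd y c ℕ.+ (tick (parity (y ℕ.+ L)) (not (parity (y ℕ.+ L))) ℕ.+ count (not (parity (y ℕ.+ L))) L c)
      ≡⟨ cong (λ z → rowOdd y c ℕ.+ (z ℕ.+ count (not (parity (y ℕ.+ L))) L c)) (tick-not (parity (y ℕ.+ L))) ⟩
    rowOdd y c ℕ.+ count (not (parity (y ℕ.+ L))) L c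
      ≡⟨ odd ⟩
    ⌈ y ℕ.+ L /2⌉
      ≡⟨ cong ⌊_/2⌋ (ℕₚ.+-suc y L) ⟨
    ⌊ y ℕ.+ suc L /2⌋ ∎) ,
  (begin
    rowOdd y (y ∷ c) ℕ.+ count (not (parity (y ℕ.+ suc L))) (suc L) (y ∷ c)
      ≡⟨ cong₂ (λ r z → r ℕ.+ count z (suc L) (y ∷ c)) rowOdd-∷ (≡.trans (cong (not ∘ parity) (ℕₚ.+-suc y L)) (not-involutive (parity (y ℕ.+ L)))) ⟩
    rowEven y c ℕ.+ (tick (parity (y ℕ.+ L)) (parity (y ℕ.+ L)) ℕ.+ count (parity (y ℕ.+ L)) L c)
      ≡⟨ cong (λ z → rowEven y c ℕ.+ (z ℕ.+ count (parity (y ℕ.+ L)) L c)) (tick-same (parity (y ℕ.+ L))) ⟩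
    rowEven y c ℕ.+ suc (count (parity (y ℕ.+ L)) L c)
      ≡⟨ ℕₚ.+-suc (rowEven y c) _ ⟩
    suc (rowEven y c ℕ.+ count (parity (y ℕ.+ L)) L c)
      ≡⟨ cong suc even ⟩
    suc ⌊ y ℕ.+ L /2⌋
      ≡⟨ cong ⌈_/2⌉ (ℕₚ.+-suc y L) ⟨
    ⌈ y ℕ.+ suc L /2⌉ ∎)
  where
  open ≡.≡-Reasoning

  leg : ∀ j → j ≤ y → y ∸ j ℕ.+ conj (y ∷ c) j ≡ suc (y ∸ j ℕ.+ conj c j)
  leg j j≤y = ≡.trans (cong (y ∸ j ℕ.+_) (conj-∷ y c j j≤y)) (ℕₚ.+-suc (y ∸ j) (conj c j))

  rowEven-∷ : rowEven y (y ∷ c) ≡ rowOdd y c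
  rowEven-∷ = #upTo-cong y (λ j j≤y → ≡.trans (cong (parity ∘ suc) (leg j j≤y)) (not-involutive _))

  rowOdd-∷ : rowOdd y (y ∷ c) ≡ rowEven y c
  rowOdd-∷ = #upTo-cong y (λ j j≤y → cong parity (leg j j≤y))

Bounded-weaken : ∀ {x y L c} → x ≤ y → Bounded x L c → Bounded y L c
Bounded-weaken x≤y [] = []
Bounded-weaken x≤y (z≤x ∷ bounded) = ℕₚ.≤-trans z≤x x≤y ∷ bounded

rowCount-+ : ∀ {x L c} d → Bounded x L c → RowCount x L c → RowCount (d ℕ.+ x) L c
rowCount-+ zero bounded counts = counts
rowCount-+ {x} (suc d) bounded counts =
  rowCount-suc (Bounded-weaken (ℕₚ.m≤n+m x d) bounded) (rowCount-+ d bounded counts)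

-- The first row is grown from the second: it starts out as long as the next part, or empty if there
-- is none, and is then lengthened cell by cell.
rowCount : ∀ {x L c} → Bounded x L c → RowCount x L c
rowCount {x} {L} [] = subst (λ z → RowCount z L []) (ℕₚ.+-identityʳ x) (rowCount-+ x [] (rowCount-[] L))
rowCount {x} {suc L} {y ∷ c} (y≤x ∷ bounded) = subst (λ z → RowCount z (suc L) (y ∷ c)) (ℕₚ.m∸n+n≡m y≤x)
  (rowCount-+ (x ∸ y) (ℕₚ.≤-refl ∷ bounded) (rowCount-∷ (rowCount bounded)))

-- Exponents

triangle : ℕ → ℕ
triangle zero = 0
triangle (suc k) = suc k ℕ.+ triangle k

-- t a b = C(a − b, 2), where a − b may be negative.
t : ℕ → ℕ → ℕ
t zero b = triangle b
t (suc a) zero = triangle a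
t (suc a) (suc b) = t a b

-- With d = a - b this is C(d+1,2) = C(d,2) + d, written without subtraction. Likewise `t-sucʳ` is
-- the passage from d to d - 1, and `t-swap` is C(d+1,2) = C(-d,2).
t-sucˡ : ∀ a b → t (suc a) b ℕ.+ b ≡ t a b ℕ.+ a
t-sucˡ zero zero = ≡.refl
t-sucˡ (suc a) zero = ≡.trans (ℕₚ.+-identityʳ _) (ℕₚ.+-comm (suc a) (triangle a))
t-sucˡ zero (suc zero) = ≡.refl
t-sucˡ zero (suc (suc b)) = begin
  triangle (suc b) ℕ.+ suc (suc b)       ≡⟨ ℕₚ.+-comm (triangle (suc b)) _ ⟩
  triangle (suc (suc b))                 ≡⟨ ℕₚ.+-identityʳ _ ⟨
  triangle (suc (suc b)) ℕ.+ 0           ∎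
  where open ≡.≡-Reasoning
t-sucˡ (suc a) (suc b) = begin
  t (suc a) b ℕ.+ suc b     ≡⟨ ℕₚ.+-suc _ b ⟩
  suc (t (suc a) b ℕ.+ b)   ≡⟨ cong suc (t-sucˡ a b) ⟩
  suc (t a b ℕ.+ a)         ≡⟨ ℕₚ.+-suc _ a ⟨
  t a b ℕ.+ suc a           ∎
  where open ≡.≡-Reasoning

t-sucʳ : ∀ a b → t a (suc b) ℕ.+ a ≡ suc (t a b ℕ.+ b)
t-sucʳ zero b = ≡.trans (ℕₚ.+-identityʳ _) (cong suc (ℕₚ.+-comm b (triangle b)))
t-sucʳ (suc zero) zero = ≡.refl
t-sucʳ (suc (suc a)) zero = ≡.trans (ℕₚ.+-comm (triangle a) _)
  (cong suc (≡.sym (ℕₚ.+-identityʳ _)))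
t-sucʳ (suc a) (suc b) = begin
  t a (suc b) ℕ.+ suc a       ≡⟨ ℕₚ.+-suc _ a ⟩
  suc (t a (suc b) ℕ.+ a)     ≡⟨ cong suc (t-sucʳ a b) ⟩
  suc (suc (t a b ℕ.+ b))     ≡⟨ cong suc (ℕₚ.+-suc _ b) ⟨
  suc (t a b ℕ.+ suc b)       ∎
  where open ≡.≡-Reasoning

t-swap : ∀ a b → t (suc a) b ≡ t b a
t-swap zero zero = ≡.refl
t-swap zero (suc zero) = ≡.refl
t-swap zero (suc (suc b)) = ≡.refl
t-swap (suc a) zero = ≡.refl
t-swap (suc a) (suc b) = t-swap a b

k≤triangle : ∀ k → k ≤ triangle k
k≤triangle zero = z≤n
k≤triangle (suc k) = ℕₚ.m≤m+n (suc k) (triangle k)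

-- This is C(d,2) ≥ -d with d = a - b; the companion `a≤t+b+1` is C(d,2) ≥ d - 1.
b≤t+a : ∀ a b → b ≤ t a b ℕ.+ a
b≤t+a zero b = ℕₚ.≤-trans (k≤triangle b) (ℕₚ.m≤m+n _ 0)
b≤t+a (suc a) zero = z≤n
b≤t+a (suc a) (suc b) = subst (suc b ≤_) (≡.sym (ℕₚ.+-suc (t a b) a)) (s≤s (b≤t+a a b))

a≤t+b+1 : ∀ a b → a ≤ suc (t a b ℕ.+ b)
a≤t+b+1 zero b = z≤n
a≤t+b+1 (suc a) zero = s≤s (ℕₚ.≤-trans (k≤triangle a) (ℕₚ.m≤m+n _ 0))
a≤t+b+1 (suc a) (suc b) = s≤s (subst (a ≤_) (≡.sym (ℕₚ.+-suc (t a b) b)) (a≤t+b+1 a b))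

-- The exponent balance of the triple product recursion: C(d+1,2) - C(d-1,2) = 2d - 1 with d = a -
-- b.
4a+t-sucʳ : ∀ a b → 4 ℕ.* a ℕ.+ t a (suc b) ≡ suc (2 ℕ.* (a ℕ.+ b)) ℕ.+ t (suc a) b
4a+t-sucʳ a b = begin
  4 ℕ.* a ℕ.+ t a (suc b)                         ≡⟨ regroup₁ a (t a (suc b)) ⟩
  (t a (suc b) ℕ.+ a) ℕ.+ 3 ℕ.* a                 ≡⟨ cong (ℕ._+ 3 ℕ.* a) (t-sucʳ a b) ⟩
  suc (t a b ℕ.+ b) ℕ.+ 3 ℕ.* a                   ≡⟨ regroup₂ a b (t a b) ⟩
  (t a b ℕ.+ a) ℕ.+ suc (b ℕ.+ 2 ℕ.* a)           ≡⟨ cong (ℕ._+ suc (b ℕ.+ 2 ℕ.* a)) (t-sucˡ a b) ⟨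
  (t (suc a) b ℕ.+ b) ℕ.+ suc (b ℕ.+ 2 ℕ.* a)     ≡⟨ regroup₃ a b (t (suc a) b) ⟩
  suc (2 ℕ.* (a ℕ.+ b)) ℕ.+ t (suc a) b           ∎
  where
  open ≡.≡-Reasoning
  regroup₁ : ∀ a z → 4 ℕ.* a ℕ.+ z ≡ (z ℕ.+ a) ℕ.+ 3 ℕ.* a
  regroup₁ = solve-∀
  regroup₂ : ∀ a b z → suc (z ℕ.+ b) ℕ.+ 3 ℕ.* a ≡ (z ℕ.+ a) ℕ.+ suc (b ℕ.+ 2 ℕ.* a)
  regroup₂ = solve-∀
  regroup₃ : ∀ a b z → (z ℕ.+ b) ℕ.+ suc (b ℕ.+ 2 ℕ.* a) ≡ suc (2 ℕ.* (a ℕ.+ b)) ℕ.+ z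
  regroup₃ = solve-∀

-- For p = -q² it makes q^(t a b) p^i vanish modulo q^(a+b+1) once i > a, so that factors of (p;p)_∞
-- beyond the a-th are not seen.
a+b<t+2iˡ : ∀ a b i → a < i → a ℕ.+ b < t a b ℕ.+ 2 ℕ.* i
a+b<t+2iˡ a b i a<i = begin-strict
  a ℕ.+ b                   ≤⟨ ℕₚ.+-monoʳ-≤ a (b≤t+a a b) ⟩
  a ℕ.+ (t a b ℕ.+ a)       <⟨ ℕₚ.+-mono-<-≤ a<i (ℕₚ.+-monoʳ-≤ (t a b) (ℕₚ.<⇒≤ a<i)) ⟩
  i ℕ.+ (t a b ℕ.+ i)       ≡⟨ regroup i (t a b) ⟩
  t a b ℕ.+ 2 ℕ.* i         ∎
  where
  open ℕₚ.≤-Reasoning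
  regroup : ∀ i z → i ℕ.+ (z ℕ.+ i) ≡ z ℕ.+ 2 ℕ.* i
  regroup = solve-∀

a+b<t+2iʳ : ∀ a b i → b < i → a ℕ.+ b < t a b ℕ.+ 2 ℕ.* i
a+b<t+2iʳ a b i b<i = begin-strict
  a ℕ.+ b                       ≤⟨ ℕₚ.+-monoˡ-≤ b (a≤t+b+1 a b) ⟩
  suc (t a b ℕ.+ b) ℕ.+ b       ≡⟨ cong (ℕ._+ b) (ℕₚ.+-suc (t a b) b) ⟨
  (t a b ℕ.+ suc b) ℕ.+ b       <⟨ ℕₚ.+-mono-≤-< (ℕₚ.+-monoʳ-≤ (t a b) b<i) b<i ⟩
  (t a b ℕ.+ i) ℕ.+ i           ≡⟨ regroup i (t a b) ⟩
  t a b ℕ.+ 2 ℕ.* i             ∎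
  where
  open ℕₚ.≤-Reasoning
  regroup : ∀ i z → (z ℕ.+ i) ℕ.+ i ≡ z ℕ.+ 2 ℕ.* i
  regroup = solve-∀

2[1+k+k] : ∀ k → 2 ℕ.* suc (k ℕ.+ k) ≡ 2 ℕ.+ 4 ℕ.* k
2[1+k+k] = solve-∀

2[2+k+k] : ∀ k → 2 ℕ.* suc (suc (k ℕ.+ k)) ≡ 4 ℕ.* suc k
2[2+k+k] = solve-∀

t-balanced : ∀ L → t ⌈ L /2⌉ ⌊ L /2⌋ ≡ 0
t-balanced zero = ≡.refl
t-balanced (suc zero) = ≡.refl
t-balanced (suc (suc L)) = t-balanced L

⌊1+k+k/2⌋ : ∀ k → ⌊ suc (k ℕ.+ k) /2⌋ ≡ k
⌊1+k+k/2⌋ k = ≡.sym (ℕₚ.n≡⌈n+n/2⌉ k)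

-- Here `B` is a new first part whose β-number is 2N, above `a` even and `b` odd ones. The power
-- p^(N-a) in Pascal's rule then supplies exactly the missing q^B. The odd case 2N + 1 is
-- `t-sucʳ-shift`.
t-sucˡ-shift : ∀ B a b N → B ℕ.+ (a ℕ.+ b) ≡ N ℕ.+ N → a ≤ N → t (suc a) b ℕ.+ 2 ℕ.* (N ∸ a) ≡ B ℕ.+ t a b
t-sucˡ-shift B a b N B≡ a≤N = ℕₚ.+-cancelʳ-≡ (a ℕ.+ b) _ _ (begin
  t (suc a) b ℕ.+ 2 ℕ.* m ℕ.+ (a ℕ.+ b)       ≡⟨ regroup₁ (t (suc a) b) m a b ⟩
  (t (suc a) b ℕ.+ b) ℕ.+ (2 ℕ.* m ℕ.+ a)     ≡⟨ cong (ℕ._+ (2 ℕ.* m ℕ.+ a)) (t-sucˡ a b) ⟩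
  (t a b ℕ.+ a) ℕ.+ (2 ℕ.* m ℕ.+ a)           ≡⟨ regroup₂ (t a b) m a ⟩
  t a b ℕ.+ ((m ℕ.+ a) ℕ.+ (m ℕ.+ a))         ≡⟨ cong (λ z → t a b ℕ.+ (z ℕ.+ z)) (ℕₚ.m∸n+n≡m a≤N) ⟩
  t a b ℕ.+ (N ℕ.+ N)                         ≡⟨ cong (t a b ℕ.+_) B≡ ⟨
  t a b ℕ.+ (B ℕ.+ (a ℕ.+ b))                 ≡⟨ regroup₃ (t a b) B (a ℕ.+ b) ⟩
  B ℕ.+ t a b ℕ.+ (a ℕ.+ b)                   ∎)
  where
  open ≡.≡-Reasoning
  m = N ∸ a
  regroup₁ : ∀ z m a b → z ℕ.+ 2 ℕ.* m ℕ.+ (a ℕ.+ b) ≡ (z ℕ.+ b) ℕ.+ (2 ℕ.* m ℕ.+ a)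
  regroup₁ = solve-∀
  regroup₂ : ∀ z m a → (z ℕ.+ a) ℕ.+ (2 ℕ.* m ℕ.+ a) ≡ z ℕ.+ ((m ℕ.+ a) ℕ.+ (m ℕ.+ a))
  regroup₂ = solve-∀
  regroup₃ : ∀ z B s → z ℕ.+ (B ℕ.+ s) ≡ B ℕ.+ z ℕ.+ s
  regroup₃ = solve-∀

t-sucʳ-shift : ∀ B a b N → B ℕ.+ (a ℕ.+ b) ≡ suc (N ℕ.+ N) → b ≤ N → t a (suc b) ℕ.+ 2 ℕ.* (N ∸ b) ≡ B ℕ.+ t a b
t-sucʳ-shift B a b N B≡ b≤N = ℕₚ.+-cancelʳ-≡ (a ℕ.+ b) _ _ (begin
  t a (suc b) ℕ.+ 2 ℕ.* m ℕ.+ (a ℕ.+ b)       ≡⟨ regroup₁ (t a (suc b)) m a b ⟩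
  (t a (suc b) ℕ.+ a) ℕ.+ (2 ℕ.* m ℕ.+ b)     ≡⟨ cong (ℕ._+ (2 ℕ.* m ℕ.+ b)) (t-sucʳ a b) ⟩
  suc (t a b ℕ.+ b) ℕ.+ (2 ℕ.* m ℕ.+ b)       ≡⟨ regroup₂ (t a b) m b ⟩
  t a b ℕ.+ suc ((m ℕ.+ b) ℕ.+ (m ℕ.+ b))     ≡⟨ cong (λ z → t a b ℕ.+ suc (z ℕ.+ z)) (ℕₚ.m∸n+n≡m b≤N) ⟩
  t a b ℕ.+ suc (N ℕ.+ N)                     ≡⟨ cong (t a b ℕ.+_) B≡ ⟨
  t a b ℕ.+ (B ℕ.+ (a ℕ.+ b))                 ≡⟨ regroup₃ (t a b) B (a ℕ.+ b) ⟩
  B ℕ.+ t a b ℕ.+ (a ℕ.+ b)                   ∎)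
  where
  open ≡.≡-Reasoning
  m = N ∸ b
  regroup₁ : ∀ z m a b → z ℕ.+ 2 ℕ.* m ℕ.+ (a ℕ.+ b) ≡ (z ℕ.+ a) ℕ.+ (2 ℕ.* m ℕ.+ b)
  regroup₁ = solve-∀
  regroup₂ : ∀ z m b → suc (z ℕ.+ b) ℕ.+ (2 ℕ.* m ℕ.+ b) ≡ z ℕ.+ suc ((m ℕ.+ b) ℕ.+ (m ℕ.+ b))
  regroup₂ = solve-∀
  regroup₃ : ∀ z B s → z ℕ.+ (B ℕ.+ s) ≡ B ℕ.+ z ℕ.+ s
  regroup₃ = solve-∀

interleave : ∀ {A : Set} → (ℕ → A) → (ℕ → A) → ℕ → A
interleave v w zero = v 0
interleave v w (suc i) = interleave w (v ∘ suc) i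

interleave-even : ∀ {A : Set} (v w : ℕ → A) k → interleave v w (k ℕ.+ k) ≡ v k
interleave-even v w zero = ≡.refl
interleave-even v w (suc k) = ≡.trans (cong (interleave w (v ∘ suc)) (ℕₚ.+-suc k k))
  (interleave-even (v ∘ suc) (w ∘ suc) k)

interleave-odd : ∀ {A : Set} (v w : ℕ → A) k → interleave v w (suc (k ℕ.+ k)) ≡ w k
interleave-odd v w k = interleave-even w (v ∘ suc) k

even⊎odd : ∀ i → ∃ (λ k → i ≡ k ℕ.+ k) ⊎ ∃ (λ k → i ≡ suc (k ℕ.+ k))
even⊎odd zero = inj₁ (0 , ≡.refl)
even⊎odd (suc i) with even⊎odd i
... | inj₁ (k , i≡) = inj₂ (k , cong suc i≡)
... | inj₂ (k , i≡) = inj₁ (suc k , cong suc (≡.trans i≡ (≡.sym (ℕₚ.+-suc k k))))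

-- Gaussian binomials and the triple product

module Algebra (R : CommutativeRing 0ℓ 0ℓ) where
  open CommutativeRing R
  open RingProperties ring using (-‿distribʳ-*; -‿distribˡ-*; -‿involutive)
  open SetoidReasoning setoid
  open NaturalCoefficients commutativeSemiring using (solve; _:+_; _:*_; _:=_; con)

  diag : ℕ → (ℕ → ℕ → Carrier) → Carrier
  diag zero h = h 0 0
  diag (suc n) h = h 0 (suc n) + diag n (λ a b → h (suc a) b)

  diag-cong : ∀ n {h k} → (∀ a b → a ℕ.+ b ≡ n → h a b ≈ k a b) → diag n h ≈ diag n k
  diag-cong zero h≈k = h≈k 0 0 ≡.refl
  diag-cong (suc n) h≈k =
    +-cong (h≈k 0 (suc n) ≡.refl) (diag-cong n (λ a b a+b≡n → h≈k (suc a) b (cong suc a+b≡n)))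

  diag-+ : ∀ n h k → diag n (λ a b → h a b + k a b) ≈ diag n h + diag n k
  diag-+ zero h k = refl
  diag-+ (suc n) h k = begin
    h 0 (suc n) + k 0 (suc n) + diag n (λ a b → h (suc a) b + k (suc a) b)  ≈⟨ +-congˡ (diag-+ n _ _) ⟩
    h 0 (suc n) + k 0 (suc n) + (diag n (λ a b → h (suc a) b) + diag n (λ a b → k (suc a) b))
      ≈⟨ solve 4 (λ w x y z → w :+ x :+ (y :+ z) := (w :+ y) :+ (x :+ z)) refl _ _ _ _ ⟩
    diag (suc n) h + diag (suc n) k ∎

  diag-*ˡ : ∀ n c h → c * diag n h ≈ diag n (λ a b → c * h a b)
  diag-*ˡ zero c h = refl
  diag-*ˡ (suc n) c h = trans (distribˡ c _ _) (+-congˡ (diag-*ˡ n c _))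

  diag-*ʳ : ∀ n c h → diag n h * c ≈ diag n (λ a b → h a b * c)
  diag-*ʳ n c h = begin
    diag n h * c               ≈⟨ *-comm _ c ⟩
    c * diag n h               ≈⟨ diag-*ˡ n c h ⟩
    diag n (λ a b → c * h a b) ≈⟨ diag-cong n (λ a b _ → *-comm c (h a b)) ⟩
    diag n (λ a b → h a b * c) ∎

  diag-last : ∀ n h → diag (suc n) h ≈ diag n (λ a b → h a (suc b)) + h (suc n) 0
  diag-last zero h = refl
  diag-last (suc n) h = trans (+-congˡ (diag-last n (λ a b → h (suc a) b))) (sym (+-assoc _ _ _))

  diag-swap : ∀ n h → diag n h ≈ diag n (λ a b → h b a)
  diag-swap zero h = refl
  diag-swap (suc n) h = begin
    h 0 (suc n) + diag n (λ a b → h (suc a) b)     ≈⟨ +-congˡ (diag-swap n (λ a b → h (suc a) b)) ⟩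
    h 0 (suc n) + diag n (λ a b → h (suc b) a)     ≈⟨ +-comm _ _ ⟩
    diag n (λ a b → h (suc b) a) + h 0 (suc n)     ≈⟨ diag-last n (λ a b → h b a) ⟨
    diag (suc n) (λ a b → h b a)                   ∎

  diag-zero : ∀ n h → (∀ a b → a ℕ.+ b ≡ n → h a b ≈ 0#) → diag n h ≈ 0#
  diag-zero zero h h≈0 = h≈0 0 0 ≡.refl
  diag-zero (suc n) h h≈0 = trans
    (+-cong (h≈0 0 (suc n) ≡.refl) (diag-zero n _ (λ a b e → h≈0 (suc a) b (cong suc e))))
    (+-identityˡ 0#)

  diag-single : ∀ c d h → (∀ a b → c < a → h a b ≈ 0#) → (∀ a b → d < b → h a b ≈ 0#) →
                diag (c ℕ.+ d) h ≈ h c d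
  diag-single zero zero h _ _ = refl
  diag-single zero (suc d) h left right = trans
    (+-congˡ (diag-zero d _ (λ a b _ → left (suc a) b (s≤s z≤n)))) (+-identityʳ _)
  diag-single (suc c) d h left right = trans
    (+-cong (right 0 (suc (c ℕ.+ d)) (s≤s (ℕₚ.m≤n+m d c)))
            (diag-single c d (λ a b → h (suc a) b)
              (λ a b c<a → left (suc a) b (s≤s c<a)) (λ a b → right (suc a) b)))
    (+-identityˡ _)

  -- The sum over all partitions with at most L parts, all of them at most b.
  ∑ : ℕ → ℕ → (List ℕ → Carrier) → Carrier
  ∑ b zero F = F []
  ∑ zero (suc L) F = F []
  ∑ (suc b) (suc L) F = ∑ b (suc L) F + ∑ (suc b) L (λ c → F (suc b ∷ c))

  ∑-cong-Bounded : ∀ b L {F G} → (∀ c → Bounded b L c → F c ≈ G c) → ∑ b L F ≈ ∑ b L G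
  ∑-cong-Bounded b zero F≈G = F≈G [] []
  ∑-cong-Bounded zero (suc L) F≈G = F≈G [] []
  ∑-cong-Bounded (suc b) (suc L) F≈G = +-cong
    (∑-cong-Bounded b (suc L) (λ c bounded → F≈G c (Bounded-weaken (ℕₚ.n≤1+n b) bounded)))
    (∑-cong-Bounded (suc b) L (λ c bounded → F≈G (suc b ∷ c) (ℕₚ.≤-refl ∷ bounded)))

  ∑-cong : ∀ b L {F G} → (∀ c → F c ≈ G c) → ∑ b L F ≈ ∑ b L G
  ∑-cong b L F≈G = ∑-cong-Bounded b L (λ c _ → F≈G c)

  σ : ℕ → Carrier
  σ zero = 1#
  σ (suc k) = - σ k

  σ-+ : ∀ i j → σ (i ℕ.+ j) ≈ σ i * σ j
  σ-+ zero j = sym (*-identityˡ (σ j))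
  σ-+ (suc i) j = trans (-‿cong (σ-+ i j)) (-‿distribˡ-* (σ i) (σ j))

  σ-square : ∀ i → σ i * σ i ≈ 1#
  σ-square zero = *-identityˡ 1#
  σ-square (suc i) = begin
    - σ i * - σ i       ≈⟨ -‿distribˡ-* (σ i) (- σ i) ⟨
    - (σ i * - σ i)     ≈⟨ -‿cong (-‿distribʳ-* (σ i) (σ i)) ⟨
    - - (σ i * σ i)     ≈⟨ -‿involutive _ ⟩
    σ i * σ i           ≈⟨ σ-square i ⟩
    1#                  ∎

  1-xy : ∀ x y → 1# - x * y ≈ (1# - x) + x * (1# - y)
  1-xy x y = sym (begin
    (1# - x) + x * (1# - y)              ≈⟨ +-congˡ (distribˡ x 1# (- y)) ⟩
    (1# - x) + (x * 1# + x * - y)        ≈⟨ +-congˡ (+-cong (*-identityʳ x) (sym (-‿distribʳ-* x y))) ⟩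
    (1# - x) + (x - x * y)
      ≈⟨ solve 4 (λ u v w z → (u :+ v) :+ (w :+ z) := (u :+ z) :+ (v :+ w)) refl 1# (- x) x (- (x * y)) ⟩
    (1# - x * y) + (- x + x)             ≈⟨ +-congˡ (-‿inverseˡ x) ⟩
    (1# - x * y) + 0#                    ≈⟨ +-identityʳ _ ⟩
    1# - x * y                           ∎)

  geometric-minus : ∀ x u → u ≈ 1# + x * u → (1# - x) * u ≈ 1#
  geometric-minus x u u≈ = begin
    (1# - x) * u                ≈⟨ distribʳ u 1# (- x) ⟩
    1# * u + - x * u            ≈⟨ +-cong (*-identityˡ u) (sym (-‿distribˡ-* x u)) ⟩
    u - x * u                   ≈⟨ +-congʳ u≈ ⟩
    (1# + x * u) - x * u        ≈⟨ +-assoc 1# (x * u) (- (x * u)) ⟩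
    1# + (x * u - x * u)        ≈⟨ +-congˡ (-‿inverseʳ (x * u)) ⟩
    1# + 0#                     ≈⟨ +-identityʳ 1# ⟩
    1#                          ∎

  geometric-plus : ∀ x u → u ≈ 1# + x * - u → (1# + x) * u ≈ 1#
  geometric-plus x u u≈ = begin
    (1# + x) * u                ≈⟨ distribʳ u 1# x ⟩
    1# * u + x * u              ≈⟨ +-congʳ (*-identityˡ u) ⟩
    u + x * u                   ≈⟨ +-congʳ u≈ ⟩
    (1# + x * - u) + x * u      ≈⟨ +-assoc 1# (x * - u) (x * u) ⟩
    1# + (x * - u + x * u)      ≈⟨ +-congˡ (distribˡ x (- u) u) ⟨
    1# + x * (- u + u)          ≈⟨ +-congˡ (trans (*-congˡ (-‿inverseˡ u)) (zeroʳ x)) ⟩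
    1# + 0#                     ≈⟨ +-identityʳ 1# ⟩
    1#                          ∎

  -- The base p enters only through its powers `x i`, so that p = q⁴ and p = -q² share one
  -- development; `u` supplies the inverses of the factors.
  module Pochhammer
    (x : ℕ → Carrier) (x-zero : x 0 ≈ 1#) (x-+ : ∀ i j → x (i ℕ.+ j) ≈ x i * x j)
    (u : ℕ → Carrier) (u-inverse : ∀ i → (1# - x (suc i)) * u i ≈ 1#) where

    -- X k = (p;p)ₖ and Y k = 1/(p;p)ₖ, where x i = pⁱ.
    X Y : ℕ → Carrier
    X zero = 1#
    X (suc k) = X k * (1# - x (suc k))
    Y zero = 1#
    Y (suc k) = Y k * u k

    X*Y : ∀ k → X k * Y k ≈ 1#
    X*Y zero = *-identityˡ 1#
    X*Y (suc k) = begin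
      (X k * (1# - x (suc k))) * (Y k * u k)
        ≈⟨ solve 4 (λ a b c d → (a :* b) :* (c :* d) := (a :* c) :* (b :* d)) refl _ _ _ _ ⟩
      (X k * Y k) * ((1# - x (suc k)) * u k)   ≈⟨ *-cong (X*Y k) (u-inverse k) ⟩
      1# * 1#                                  ≈⟨ *-identityˡ 1# ⟩
      1#                                       ∎

    Y-step : ∀ k → (1# - x (suc k)) * Y (suc k) ≈ Y k
    Y-step k = begin
      (1# - x (suc k)) * (Y k * u k)
        ≈⟨ solve 3 (λ a b c → a :* (b :* c) := b :* (a :* c)) refl _ _ _ ⟩
      Y k * ((1# - x (suc k)) * u k)    ≈⟨ *-congˡ (u-inverse k) ⟩
      Y k * 1#                          ≈⟨ *-identityʳ _ ⟩
      Y k                               ∎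

    -- Gaussian binomials; for a > N the truncated N ∸ a is harmless as g N a = 0.
    g : ℕ → ℕ → Carrier
    g N zero = 1#
    g zero (suc a) = 0#
    g (suc N) (suc a) = g N (suc a) + x (N ∸ a) * g N a

    g-> : ∀ N a → N < a → g N a ≈ 0#
    g-> zero (suc a) _ = refl
    g-> (suc N) (suc a) (s≤s N<a) = begin
      g N (suc a) + x (N ∸ a) * g N a   ≈⟨ +-cong (g-> N (suc a) (ℕₚ.m≤n⇒m≤1+n N<a)) (*-congˡ (g-> N a N<a)) ⟩
      0# + x (N ∸ a) * 0#               ≈⟨ +-identityˡ _ ⟩
      x (N ∸ a) * 0#                    ≈⟨ zeroʳ _ ⟩
      0#                                ∎

    g-diagonal : ∀ N → g N N ≈ 1#
    g-diagonal zero = refl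
    g-diagonal (suc N) = begin
      g N (suc N) + x (N ∸ N) * g N N   ≈⟨ +-cong (g-> N (suc N) ℕₚ.≤-refl)
                                             (*-cong (trans (reflexive (cong x (ℕₚ.n∸n≡0 N))) x-zero) (g-diagonal N)) ⟩
      0# + 1# * 1#                      ≈⟨ +-identityˡ _ ⟩
      1# * 1#                           ≈⟨ *-identityˡ 1# ⟩
      1#                                ∎

    -- The quotient formula for Gaussian binomials, cleared of denominators. Pascal's rule leads to
    -- two smaller cases with the same right side, whose coefficients add up by 1 - p^(a+b+2) = (1 -
    -- p^(b+1)) + p^(b+1) (1 - p^(a+1)).
    g-X : ∀ a b → g (a ℕ.+ b) a * (X a * X b) ≈ X (a ℕ.+ b)
    g-X zero b = trans (*-identityˡ _) (*-identityˡ _)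
    g-X (suc a) zero = begin
      g (suc (a ℕ.+ 0)) (suc a) * (X (suc a) * 1#)   ≈⟨ *-cong (reflexive (cong (λ N → g N (suc a)) (ℕₚ.+-identityʳ (suc a)))) (*-identityʳ _) ⟩
      g (suc a) (suc a) * X (suc a)                  ≈⟨ *-congʳ (g-diagonal (suc a)) ⟩
      1# * X (suc a)                                 ≈⟨ *-identityˡ _ ⟩
      X (suc a)                                      ≈⟨ reflexive (cong X (ℕₚ.+-identityʳ (suc a))) ⟨
      X (suc a ℕ.+ 0)                                ∎
    g-X (suc a) (suc b) = begin
      (g (a ℕ.+ suc b) (suc a) + x (a ℕ.+ suc b ∸ a) * g (a ℕ.+ suc b) a) * (X (suc a) * X (suc b))
        ≈⟨ *-congʳ (+-cong (reflexive (cong (λ N → g N (suc a)) (ℕₚ.+-suc a b)))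
                           (*-congʳ (reflexive (cong x (ℕₚ.m+n∸m≡n a (suc b)))))) ⟩
      (g (suc a ℕ.+ b) (suc a) + x (suc b) * g (a ℕ.+ suc b) a) * ((X a * (1# - x (suc a))) * (X b * (1# - x (suc b))))
        ≈⟨ solve 7 (λ G H z A A₁ B B₁ →
             (G :+ z :* H) :* ((A :* A₁) :* (B :* B₁)) :=
             B₁ :* (G :* ((A :* A₁) :* B)) :+ (z :* A₁) :* (H :* (A :* (B :* B₁))))
             refl (g (suc a ℕ.+ b) (suc a)) (g (a ℕ.+ suc b) a) (x (suc b)) (X a) (1# - x (suc a)) (X b) (1# - x (suc b)) ⟩
      (1# - x (suc b)) * (g (suc a ℕ.+ b) (suc a) * (X (suc a) * X b))
        + (x (suc b) * (1# - x (suc a))) * (g (a ℕ.+ suc b) a * (X a * X (suc b)))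
        ≈⟨ +-cong (*-congˡ (g-X (suc a) b)) (*-congˡ (trans (g-X a (suc b)) (reflexive (cong X (ℕₚ.+-suc a b))))) ⟩
      (1# - x (suc b)) * X (suc a ℕ.+ b) + (x (suc b) * (1# - x (suc a))) * X (suc a ℕ.+ b)
        ≈⟨ distribʳ _ _ _ ⟨
      ((1# - x (suc b)) + x (suc b) * (1# - x (suc a))) * X (suc a ℕ.+ b)
        ≈⟨ *-comm _ _ ⟩
      X (suc a ℕ.+ b) * ((1# - x (suc b)) + x (suc b) * (1# - x (suc a)))
        ≈⟨ *-congˡ (1-xy (x (suc b)) (x (suc a))) ⟨
      X (suc a ℕ.+ b) * (1# - x (suc b) * x (suc a))
        ≈⟨ *-congˡ (+-congˡ (-‿cong (trans (*-comm _ _) (sym (x-+ (suc a) (suc b)))))) ⟩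
      X (suc a ℕ.+ b) * (1# - x (suc a ℕ.+ suc b))
        ≈⟨ reflexive (cong (λ N → X N * (1# - x (suc a ℕ.+ suc b))) (ℕₚ.+-suc a b)) ⟨
      X (suc a ℕ.+ suc b) ∎

    g-Y : ∀ a b → g (a ℕ.+ b) a ≈ X (a ℕ.+ b) * (Y a * Y b)
    g-Y a b = sym (begin
      X (a ℕ.+ b) * (Y a * Y b)                        ≈⟨ *-congʳ (g-X a b) ⟨
      (g (a ℕ.+ b) a * (X a * X b)) * (Y a * Y b)
        ≈⟨ solve 5 (λ G A B C D → (G :* (A :* B)) :* (C :* D) := G :* ((A :* C) :* (B :* D))) refl _ _ _ _ _ ⟩
      g (a ℕ.+ b) a * ((X a * Y a) * (X b * Y b))      ≈⟨ *-congˡ (*-cong (X*Y a) (X*Y b)) ⟩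
      g (a ℕ.+ b) a * (1# * 1#)                        ≈⟨ *-congˡ (*-identityˡ 1#) ⟩
      g (a ℕ.+ b) a * 1#                               ≈⟨ *-identityʳ _ ⟩
      g (a ℕ.+ b) a                                    ∎)

    s*[1-x] : ∀ s i → s * x i ≈ 0# → s * (1# - x i) ≈ s
    s*[1-x] s i sx≈0 = begin
      s * (1# - x i)            ≈⟨ distribˡ s 1# (- x i) ⟩
      s * 1# + s * - x i        ≈⟨ +-cong (*-identityʳ s) (sym (-‿distribʳ-* s (x i))) ⟩
      s - s * x i               ≈⟨ +-congˡ (-‿cong sx≈0) ⟩
      s - 0#                    ≈⟨ +-congˡ (RingProperties.-0#≈0# ring) ⟩
      s + 0#                    ≈⟨ +-identityʳ s ⟩
      s                         ∎

    -- Multiplication by `s`, in use a power of q, kills p^i beyond `k`, so all later factors 1 -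
    -- p^i act on it as 1.
    module Stable (s : Carrier) (k : ℕ) (s*x≈0 : ∀ i → k < i → s * x i ≈ 0#) where

      s*Y : ∀ d → s * Y (d ℕ.+ k) ≈ s * Y k
      s*Y zero = refl
      s*Y (suc d) = begin
        s * (Y (d ℕ.+ k) * u (d ℕ.+ k))
          -- A factor that acts trivially on `s` is inserted in order to cancel the last `u`.
          ≈⟨ *-congʳ (s*[1-x] s _ (s*x≈0 _ (s≤s (ℕₚ.m≤n+m k d)))) ⟨
        (s * (1# - x (suc d ℕ.+ k))) * (Y (d ℕ.+ k) * u (d ℕ.+ k))
          ≈⟨ *-assoc _ _ _ ⟩
        s * ((1# - x (suc d ℕ.+ k)) * Y (suc d ℕ.+ k))  ≈⟨ *-congˡ (Y-step (d ℕ.+ k)) ⟩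
        s * Y (d ℕ.+ k)                                 ≈⟨ s*Y d ⟩
        s * Y k                                         ∎

  module Truncated
    (q^ : ℕ → Carrier) (q^-zero : q^ 0 ≈ 1#) (q^-+ : ∀ i j → q^ (i ℕ.+ j) ≈ q^ i * q^ j)
    (e o : ℕ → Carrier)
    (e-inverse : ∀ i → (1# - q^ (4 ℕ.* suc i)) * e i ≈ 1#)
    (o-inverse : ∀ i → (1# + q^ (2 ℕ.+ 4 ℕ.* i)) * o i ≈ 1#)
    (n : ℕ) (q^-large : ∀ i → n < i → q^ i ≈ 0#) where

    q^-cong : ∀ {i j} → i ≡ j → q^ i ≈ q^ j
    q^-cong i≡j = reflexive (cong q^ i≡j)

    x₄ x₂ : ℕ → Carrier
    x₄ i = q^ (4 ℕ.* i)
    x₂ i = σ i * q^ (2 ℕ.* i)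

    x₄-+ : ∀ i j → x₄ (i ℕ.+ j) ≈ x₄ i * x₄ j
    x₄-+ i j = trans (q^-cong (ℕₚ.*-distribˡ-+ 4 i j)) (q^-+ (4 ℕ.* i) (4 ℕ.* j))

    x₂-+ : ∀ i j → x₂ (i ℕ.+ j) ≈ x₂ i * x₂ j
    x₂-+ i j = begin
      σ (i ℕ.+ j) * q^ (2 ℕ.* (i ℕ.+ j))             ≈⟨ *-cong (σ-+ i j) (trans (q^-cong (ℕₚ.*-distribˡ-+ 2 i j)) (q^-+ (2 ℕ.* i) (2 ℕ.* j))) ⟩
      (σ i * σ j) * (q^ (2 ℕ.* i) * q^ (2 ℕ.* j))
        ≈⟨ solve 4 (λ a b c d → (a :* b) :* (c :* d) := (a :* c) :* (b :* d)) refl _ _ _ _ ⟩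
      x₂ i * x₂ j ∎

    σ-double : ∀ k → σ (k ℕ.+ k) ≈ 1#
    σ-double k = trans (σ-+ k k) (σ-square k)

    -- For p = -q² the factor 1 - p^(i+1) is 1 + q^(4k+2) when i = 2k and 1 - q^(4k+4) when i = 2k +
    -- 1, so the two kinds of inverse alternate, starting with `o`.
    u₂ : ℕ → Carrier
    u₂ = interleave o e

    u₂-inverse : ∀ i → (1# - x₂ (suc i)) * u₂ i ≈ 1#
    u₂-inverse i with even⊎odd i
    ... | inj₁ (k , ≡.refl) = begin
      (1# - - σ (k ℕ.+ k) * q^ (2 ℕ.* suc (k ℕ.+ k))) * u₂ (k ℕ.+ k)
        ≈⟨ *-cong (+-congˡ (-‿cong (sym (-‿distribˡ-* _ _)))) (reflexive (interleave-even o e k)) ⟩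
      (1# - - (σ (k ℕ.+ k) * q^ (2 ℕ.* suc (k ℕ.+ k)))) * o k
        ≈⟨ *-congʳ (+-congˡ (-‿involutive _)) ⟩
      (1# + σ (k ℕ.+ k) * q^ (2 ℕ.* suc (k ℕ.+ k))) * o k
        ≈⟨ *-congʳ (+-congˡ (trans (*-congʳ (σ-double k)) (*-identityˡ _))) ⟩
      (1# + q^ (2 ℕ.* suc (k ℕ.+ k))) * o k
        ≈⟨ *-congʳ (+-congˡ (q^-cong (2[1+k+k] k))) ⟩
      (1# + q^ (2 ℕ.+ 4 ℕ.* k)) * o k
        ≈⟨ o-inverse k ⟩
      1# ∎
    ... | inj₂ (k , ≡.refl) = begin
      (1# - σ (suc (suc (k ℕ.+ k))) * q^ (2 ℕ.* suc (suc (k ℕ.+ k)))) * u₂ (suc (k ℕ.+ k))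
        ≈⟨ *-cong (+-congˡ (-‿cong (trans (*-congʳ (trans (-‿involutive _) (σ-double k))) (*-identityˡ _))))
                  (reflexive (interleave-odd o e k)) ⟩
      (1# - q^ (2 ℕ.* suc (suc (k ℕ.+ k)))) * e k
        ≈⟨ *-congʳ (+-congˡ (-‿cong (q^-cong (2[2+k+k] k)))) ⟩
      (1# - q^ (4 ℕ.* suc k)) * e k
        ≈⟨ e-inverse k ⟩
      1# ∎

    module P₄ = Pochhammer x₄ q^-zero x₄-+ e e-inverse
    module P₂ = Pochhammer x₂ (trans (*-identityˡ _) q^-zero) x₂-+ u₂ u₂-inverse

    O A : ℕ → Carrier
    O zero = 1#
    O (suc k) = O k * o k
    A zero = 1#
    A (suc k) = A k * (1# + q^ (suc (2 ℕ.* k)))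

    Y₂-double : ∀ k → P₂.Y (k ℕ.+ k) ≈ O k * P₄.Y k
    Y₂-double zero = sym (*-identityˡ 1#)
    Y₂-double (suc k) = begin
      P₂.Y (suc k ℕ.+ suc k)
        ≈⟨ reflexive (cong (P₂.Y ∘ suc) (ℕₚ.+-suc k k)) ⟩
      (P₂.Y (k ℕ.+ k) * u₂ (k ℕ.+ k)) * u₂ (suc (k ℕ.+ k))
        ≈⟨ *-cong (*-cong (Y₂-double k) (reflexive (interleave-even o e k))) (reflexive (interleave-odd o e k)) ⟩
      ((O k * P₄.Y k) * o k) * e k
        ≈⟨ solve 4 (λ a b c d → ((a :* b) :* c) :* d := (a :* c) :* (b :* d)) refl _ _ _ _ ⟩
      O (suc k) * P₄.Y (suc k) ∎

    -- The sum of the finite triple product divided by (q⁴;q⁴)ₘ. In this form 1 - q^(4a) cancels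
    -- directly against `P₄.Y a`, and no recursion for binomials is needed.
    J : ℕ → Carrier
    J m = diag m (λ a b → q^ (t a b) * (P₄.Y a * P₄.Y b))

    -- Split 1 − q^(4(a+b)) as (1 − q^(4a)) + q^(4a) (1 − q^(4b)), then exchange a and b.
    J-step : ∀ m → (1# - x₄ (suc m)) * J (suc m) ≈ (1# + q^ (suc (2 ℕ.* m))) * J m
    J-step m = begin
      (1# - x₄ (suc m)) * diag (suc m) h
        ≈⟨ diag-*ˡ (suc m) _ h ⟩
      diag (suc m) (λ a b → (1# - x₄ (suc m)) * h a b)
        ≈⟨ diag-cong (suc m) split ⟩
      diag (suc m) (λ a b → h₁ a b + h₂ a b)
        ≈⟨ diag-+ (suc m) h₁ h₂ ⟩
      diag (suc m) h₁ + diag (suc m) h₂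
        -- The end terms a = 0 of `h₁` and b = 0 of `h₂` carry the factor 1 - q⁰ = 0; what is left
        -- are two sums over the shorter diagonal.
        ≈⟨ +-cong (trans (+-congʳ (vanish (h 0 (suc m)))) (+-identityˡ _))
                  (trans (diag-last m h₂) (trans (+-congˡ (trans (*-congˡ (vanish (h (suc m) 0))) (zeroʳ _))) (+-identityʳ _))) ⟩
      diag m (λ a b → h₁ (suc a) b) + diag m (λ a b → h₂ a (suc b))
        ≈⟨ +-cong (diag-cong m (λ a b _ → left a b)) (diag-cong m right) ⟩
      diag m h′ + diag m (λ a b → q^ (suc (2 ℕ.* m)) * h′ a b)
        ≈⟨ +-congˡ (diag-*ˡ m _ h′) ⟨
      diag m h′ + q^ (suc (2 ℕ.* m)) * diag m h′
        ≈⟨ solve 2 (λ c d → d :+ c :* d := (con 1 :+ c) :* d) refl _ _ ⟩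
      (1# + q^ (suc (2 ℕ.* m))) * diag m h′
        ≈⟨ *-congˡ (diag-swap m h′) ⟩
      (1# + q^ (suc (2 ℕ.* m))) * diag m (λ a b → h′ b a)
        ≈⟨ *-congˡ (diag-cong m (λ a b _ → *-cong (q^-cong (t-swap b a)) (*-comm _ _))) ⟩
      (1# + q^ (suc (2 ℕ.* m))) * J m ∎
      where
      h h₁ h₂ h′ : ℕ → ℕ → Carrier
      h a b = q^ (t a b) * (P₄.Y a * P₄.Y b)
      h₁ a b = (1# - x₄ a) * h a b
      h₂ a b = x₄ a * ((1# - x₄ b) * h a b)
      h′ a b = q^ (t (suc a) b) * (P₄.Y a * P₄.Y b)

      split : ∀ a b → a ℕ.+ b ≡ suc m →
              (1# - x₄ (suc m)) * h a b ≈ h₁ a b + h₂ a b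
      split a b a+b≡ = begin
        (1# - x₄ (suc m)) * h a b       ≈⟨ *-congʳ (+-congˡ (-‿cong (trans (reflexive (cong x₄ (≡.sym a+b≡))) (x₄-+ a b)))) ⟩
        (1# - x₄ a * x₄ b) * h a b      ≈⟨ *-congʳ (1-xy (x₄ a) (x₄ b)) ⟩
        ((1# - x₄ a) + x₄ a * (1# - x₄ b)) * h a b
          ≈⟨ solve 4 (λ u v w z → (u :+ v :* w) :* z := u :* z :+ v :* (w :* z)) refl _ _ _ _ ⟩
        h₁ a b + h₂ a b ∎

      vanish : ∀ c → (1# - x₄ 0) * c ≈ 0#
      vanish c = trans (*-congʳ (trans (+-congˡ (-‿cong q^-zero)) (-‿inverseʳ 1#))) (zeroˡ c)

      left : ∀ a b → h₁ (suc a) b ≈ h′ a b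
      left a b = begin
        (1# - x₄ (suc a)) * (q^ (t (suc a) b) * (P₄.Y (suc a) * P₄.Y b))
          ≈⟨ solve 4 (λ u v w z → u :* (v :* (w :* z)) := v :* ((u :* w) :* z)) refl _ _ _ _ ⟩
        q^ (t (suc a) b) * (((1# - x₄ (suc a)) * P₄.Y (suc a)) * P₄.Y b)
          ≈⟨ *-congˡ (*-congʳ (P₄.Y-step a)) ⟩
        h′ a b ∎

      right : ∀ a b → a ℕ.+ b ≡ m → h₂ a (suc b) ≈ q^ (suc (2 ℕ.* m)) * h′ a b
      right a b a+b≡m = begin
        x₄ a * ((1# - x₄ (suc b)) * (q^ (t a (suc b)) * (P₄.Y a * P₄.Y (suc b))))
          ≈⟨ solve 5 (λ z u v w y → z :* (u :* (v :* (w :* y))) := (z :* v) :* (w :* (u :* y))) refl _ _ _ _ _ ⟩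
        (x₄ a * q^ (t a (suc b))) * (P₄.Y a * ((1# - x₄ (suc b)) * P₄.Y (suc b)))
          ≈⟨ *-cong (sym (q^-+ _ _)) (*-congˡ (P₄.Y-step b)) ⟩
        q^ (4 ℕ.* a ℕ.+ t a (suc b)) * (P₄.Y a * P₄.Y b)
          ≈⟨ *-congʳ (trans (q^-cong (≡.trans (4a+t-sucʳ a b) (cong (λ z → suc (2 ℕ.* z) ℕ.+ t (suc a) b) a+b≡m))) (q^-+ _ _)) ⟩
        (q^ (suc (2 ℕ.* m)) * q^ (t (suc a) b)) * (P₄.Y a * P₄.Y b)
          ≈⟨ *-assoc _ _ _ ⟩
        q^ (suc (2 ℕ.* m)) * h′ a b ∎

    -- The finite Jacobi triple product, as (q⁴;q⁴)ₘ `P₄.Y a * P₄.Y b` is a Gaussian binomial when a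
    -- + b = m.
    X*J≈A : ∀ m → P₄.X m * J m ≈ A m
    X*J≈A zero = begin
      1# * (q^ 0 * (1# * 1#))   ≈⟨ *-identityˡ _ ⟩
      q^ 0 * (1# * 1#)          ≈⟨ *-cong q^-zero (*-identityˡ 1#) ⟩
      1# * 1#                   ≈⟨ *-identityˡ 1# ⟩
      1#                        ∎
    X*J≈A (suc m) = begin
      (P₄.X m * (1# - x₄ (suc m))) * J (suc m)           ≈⟨ *-assoc _ _ _ ⟩
      P₄.X m * ((1# - x₄ (suc m)) * J (suc m))           ≈⟨ *-congˡ (J-step m) ⟩
      P₄.X m * ((1# + q^ (suc (2 ℕ.* m))) * J m)
        ≈⟨ solve 3 (λ a b c → a :* (b :* c) := (a :* c) :* b) refl _ _ _ ⟩
      (P₄.X m * J m) * (1# + q^ (suc (2 ℕ.* m)))         ≈⟨ *-congʳ (X*J≈A m) ⟩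
      A (suc m)                                          ∎

    -- Replacing Gaussian binomials by their limits modulo q^(n+1)

    θ : Carrier
    θ = diag n (λ a b → q^ (t a b))

    -- The hypothesis has 2i although the exponent is 4i: the bound for -q² serves both bases, so
    -- that `Limit` applies to each.
    q^*x₄≈0 : ∀ m i → n < m ℕ.+ 2 ℕ.* i → q^ m * x₄ i ≈ 0#
    q^*x₄≈0 m i n< = trans (sym (q^-+ m (4 ℕ.* i)))
      (q^-large _ (ℕₚ.<-≤-trans n< (ℕₚ.+-monoʳ-≤ m (ℕₚ.*-monoˡ-≤ i (s≤s (s≤s (z≤n {2})))))))

    q^*x₂≈0 : ∀ m i → n < m ℕ.+ 2 ℕ.* i → q^ m * x₂ i ≈ 0#
    q^*x₂≈0 m i n< = begin
      q^ m * (σ i * q^ (2 ℕ.* i))    ≈⟨ solve 3 (λ a b c → a :* (b :* c) := b :* (a :* c)) refl _ _ _ ⟩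
      σ i * (q^ m * q^ (2 ℕ.* i))    ≈⟨ *-congˡ (trans (sym (q^-+ m (2 ℕ.* i))) (q^-large _ n<)) ⟩
      σ i * 0#                       ≈⟨ zeroʳ _ ⟩
      0#                             ∎

    module Limit
      (x : ℕ → Carrier) (x-zero : x 0 ≈ 1#) (x-+ : ∀ i j → x (i ℕ.+ j) ≈ x i * x j)
      (u : ℕ → Carrier) (u-inverse : ∀ i → (1# - x (suc i)) * u i ≈ 1#)
      (q^*x≈0 : ∀ m i → n < m ℕ.+ 2 ℕ.* i → q^ m * x i ≈ 0#) where

      open Pochhammer x x-zero x-+ u u-inverse

      module _ (a b : ℕ) (a+b≡n : a ℕ.+ b ≡ n) where

        q^*Yˡ : q^ (t a b) * Y a ≈ q^ (t a b) * Y n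
        q^*Yˡ = sym (trans (*-congˡ (reflexive (cong Y (≡.trans (≡.sym a+b≡n) (ℕₚ.+-comm a b)))))
          (Stable.s*Y (q^ (t a b)) a (λ i a<i → q^*x≈0 (t a b) i (subst (_< t a b ℕ.+ 2 ℕ.* i) a+b≡n (a+b<t+2iˡ a b i a<i))) b))

        q^*Yʳ : q^ (t a b) * Y b ≈ q^ (t a b) * Y n
        q^*Yʳ = sym (trans (*-congˡ (reflexive (cong Y (≡.sym a+b≡n))))
          (Stable.s*Y (q^ (t a b)) b (λ i b<i → q^*x≈0 (t a b) i (subst (_< t a b ℕ.+ 2 ℕ.* i) a+b≡n (a+b<t+2iʳ a b i b<i))) a))

        q^*YY : q^ (t a b) * (Y a * Y b) ≈ q^ (t a b) * (Y n * Y n)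
        q^*YY = begin
          q^ (t a b) * (Y a * Y b)      ≈⟨ *-assoc _ _ _ ⟨
          (q^ (t a b) * Y a) * Y b      ≈⟨ *-congʳ q^*Yˡ ⟩
          (q^ (t a b) * Y n) * Y b      ≈⟨ solve 3 (λ z v w → (z :* v) :* w := (z :* w) :* v) refl _ _ _ ⟩
          (q^ (t a b) * Y b) * Y n      ≈⟨ *-congʳ q^*Yʳ ⟩
          (q^ (t a b) * Y n) * Y n      ≈⟨ *-assoc _ _ _ ⟩
          q^ (t a b) * (Y n * Y n)      ∎

        -- By `g-Y` the left side is q^(t a b) times one Gaussian binomial.
        q^*X[YY] : q^ (t a b) * (X n * (Y a * Y b)) ≈ q^ (t a b) * Y n
        q^*X[YY] = begin
          q^ (t a b) * (X n * (Y a * Y b))      ≈⟨ solve 3 (λ z v w → z :* (v :* w) := v :* (z :* w)) refl _ _ _ ⟩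
          X n * (q^ (t a b) * (Y a * Y b))      ≈⟨ *-congˡ q^*YY ⟩
          X n * (q^ (t a b) * (Y n * Y n))      ≈⟨ solve 3 (λ z v w → v :* (z :* (w :* w)) := z :* ((v :* w) :* w)) refl _ _ _ ⟩
          q^ (t a b) * ((X n * Y n) * Y n)      ≈⟨ *-congˡ (trans (*-congʳ (X*Y n)) (*-identityˡ _)) ⟩
          q^ (t a b) * Y n                      ∎

        q^*gg : q^ (t a b) * (g n a * g n b) ≈ q^ (t a b) * (Y n * Y n)
        q^*gg = begin
          q^ (t a b) * (g n a * g n b)
            ≈⟨ *-congˡ (*-cong (gauss a b a+b≡n) (trans (gauss b a (≡.trans (ℕₚ.+-comm b a) a+b≡n)) (*-congˡ (*-comm _ _)))) ⟩
          q^ (t a b) * ((X n * (Y a * Y b)) * (X n * (Y a * Y b)))  ≈⟨ *-assoc _ _ _ ⟨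
          -- The power of q survives each replacement, so it can be spent on the two binomials in
          -- turn.
          (q^ (t a b) * (X n * (Y a * Y b))) * (X n * (Y a * Y b))  ≈⟨ *-congʳ q^*X[YY] ⟩
          (q^ (t a b) * Y n) * (X n * (Y a * Y b))                  ≈⟨ solve 3 (λ z v w → (z :* v) :* w := (z :* w) :* v) refl _ _ _ ⟩
          (q^ (t a b) * (X n * (Y a * Y b))) * Y n                  ≈⟨ *-congʳ q^*X[YY] ⟩
          (q^ (t a b) * Y n) * Y n                                  ≈⟨ *-assoc _ _ _ ⟩
          q^ (t a b) * (Y n * Y n)                                  ∎
          where
          gauss : ∀ a b → a ℕ.+ b ≡ n → g n a ≈ X n * (Y a * Y b)
          gauss a b ≡.refl = g-Y a b

      diag-YY : diag n (λ a b → q^ (t a b) * (Y a * Y b)) ≈ θ * (Y n * Y n)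
      diag-YY = trans (diag-cong n q^*YY) (sym (diag-*ʳ n _ _))

      diag-gg : diag n (λ a b → q^ (t a b) * (g n a * g n b)) ≈ θ * (Y n * Y n)
      diag-gg = trans (diag-cong n q^*gg) (sym (diag-*ʳ n _ _))

      -- `Y₂-double` factors `P₂.Y` only at even indices, so the index `n` has to be exchanged for
      -- `n + n`.
      Y-double : Y (n ℕ.+ n) ≈ Y n
      Y-double = trans (sym (*-identityˡ _))
        (trans (Stable.s*Y 1# n (λ i n<i → trans (*-congʳ (sym q^-zero)) (q^*x≈0 0 i (ℕₚ.<-≤-trans n<i (ℕₚ.m≤m+n i _)))) n) (*-identityˡ _))

    module L₄ = Limit x₄ q^-zero x₄-+ e e-inverse q^*x₄≈0
    module L₂ = Limit x₂ (trans (*-identityˡ _) q^-zero) x₂-+ u₂ u₂-inverse q^*x₂≈0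

    A≈θ*Y : A n ≈ θ * P₄.Y n
    A≈θ*Y = begin
      A n                                    ≈⟨ X*J≈A n ⟨
      P₄.X n * J n                           ≈⟨ *-congˡ L₄.diag-YY ⟩
      P₄.X n * (θ * (P₄.Y n * P₄.Y n))       ≈⟨ solve 3 (λ z v w → v :* (z :* (w :* w)) := (v :* w) :* (z :* w)) refl _ _ _ ⟩
      (P₄.X n * P₄.Y n) * (θ * P₄.Y n)       ≈⟨ *-congʳ (P₄.X*Y n) ⟩
      1# * (θ * P₄.Y n)                      ≈⟨ *-identityˡ _ ⟩
      θ * P₄.Y n                             ∎

    diag-gg≈product : diag n (λ a b → q^ (t a b) * (P₂.g n a * P₂.g n b)) ≈ A n * (P₄.Y n * (O n * O n))
    diag-gg≈product = begin
      diag n (λ a b → q^ (t a b) * (P₂.g n a * P₂.g n b))   ≈⟨ L₂.diag-gg ⟩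
      θ * (P₂.Y n * P₂.Y n)                                 ≈⟨ *-congˡ (*-cong L₂.Y-double L₂.Y-double) ⟨
      θ * (P₂.Y (n ℕ.+ n) * P₂.Y (n ℕ.+ n))                 ≈⟨ *-congˡ (*-cong (Y₂-double n) (Y₂-double n)) ⟩
      θ * ((O n * P₄.Y n) * (O n * P₄.Y n))                 ≈⟨ solve 3 (λ z v w → z :* ((v :* w) :* (v :* w)) := (z :* w) :* (w :* (v :* v))) refl _ _ _ ⟩
      (θ * P₄.Y n) * (P₄.Y n * (O n * O n))                 ≈⟨ *-congʳ A≈θ*Y ⟨
      A n * (P₄.Y n * (O n * O n))                          ∎

    -- The signed generating function of partitions in a box

    open P₂ using (g; g->; g-diagonal)

    -- On partitions this is (−1)^(even hooks) q^size.
    weight : ℕ → List ℕ → Carrier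
    weight L [] = 1#
    weight zero (x ∷ c) = 1#
    weight (suc L) (x ∷ c) =
      σ ⌊ x ℕ.+ L /2⌋ * σ (count (parity (x ℕ.+ L)) L c) * q^ x * weight L c

    -- The arbitrary ω, a function of the numbers of even and odd β-numbers, absorbs
    -- the factor contributed by the first part in the induction.
    Formula : ℕ → ℕ → ℕ → ℕ → Set
    Formula b L N₀ N₁ = ∀ (ω : ℕ → ℕ → Carrier) →
      ∑ b L (λ c → ω (count true L c) (count false L c) * weight L c) ≈
      diag L (λ a a′ → ω a a′ * (q^ (t a a′) * (g N₀ a * g N₁ a′)))

    -- Matches the second term of Pascal's rule with a new first part `B`. The sign of (-q²)^(N-a)
    -- is σ(N) σ(a), where N is the floor of half the new β-number and a counts the later ones of
    -- the same parity.
    x₂*g-≤ : ∀ N a B T T′ → a ≤ N → T′ ℕ.+ 2 ℕ.* (N ∸ a) ≡ B ℕ.+ T →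
             q^ T′ * (x₂ (N ∸ a) * g N a) ≈ (σ N * σ a * q^ B) * (q^ T * g N a)
    x₂*g-≤ N a B T T′ a≤N exponent = begin
      q^ T′ * ((σ (N ∸ a) * q^ (2 ℕ.* (N ∸ a))) * g N a)
        ≈⟨ solve 4 (λ s v w z → s :* ((v :* w) :* z) := v :* (s :* w) :* z) refl (q^ T′) (σ (N ∸ a)) (q^ (2 ℕ.* (N ∸ a))) (g N a) ⟩
      σ (N ∸ a) * (q^ T′ * q^ (2 ℕ.* (N ∸ a))) * g N a
        ≈⟨ *-congʳ (*-cong sign (trans (sym (q^-+ T′ (2 ℕ.* (N ∸ a)))) (trans (q^-cong exponent) (q^-+ B T)))) ⟩
      σ N * σ a * (q^ B * q^ T) * g N a
        ≈⟨ solve 4 (λ s v w z → s :* (v :* w) :* z := s :* v :* (w :* z)) refl (σ N * σ a) (q^ B) (q^ T) (g N a) ⟩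
      σ N * σ a * q^ B * (q^ T * g N a) ∎
      where
      sign : σ (N ∸ a) ≈ σ N * σ a
      sign = sym (begin
        σ N * σ a                    ≈⟨ *-congʳ (trans (reflexive (cong σ (≡.sym (ℕₚ.m∸n+n≡m a≤N)))) (σ-+ (N ∸ a) a)) ⟩
        σ (N ∸ a) * σ a * σ a        ≈⟨ *-assoc _ _ _ ⟩
        σ (N ∸ a) * (σ a * σ a)      ≈⟨ *-congˡ (σ-square a) ⟩
        σ (N ∸ a) * 1#               ≈⟨ *-identityʳ _ ⟩
        σ (N ∸ a)                    ∎)

    -- For `a > N` both sides are 0 because `g N a` is, so the exponents have to match only for
    -- `a ≤ N`.
    x₂*g : ∀ N a B T T′ → (a ≤ N → T′ ℕ.+ 2 ℕ.* (N ∸ a) ≡ B ℕ.+ T) →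
           q^ T′ * (x₂ (N ∸ a) * g N a) ≈ (σ N * σ a * q^ B) * (q^ T * g N a)
    x₂*g N a B T T′ exponent = [ (λ a≤N → x₂*g-≤ N a B T T′ a≤N (exponent a≤N)) , vanish ]′ (ℕₚ.≤-<-connex a N)
      where
      vanish : N < a → q^ T′ * (x₂ (N ∸ a) * g N a) ≈ (σ N * σ a * q^ B) * (q^ T * g N a)
      vanish N<a = begin
        q^ T′ * (x₂ (N ∸ a) * g N a)           ≈⟨ *-congˡ (*-congˡ (g-> N a N<a)) ⟩
        q^ T′ * (x₂ (N ∸ a) * 0#)              ≈⟨ trans (*-congˡ (zeroʳ _)) (zeroʳ _) ⟩
        0#                                     ≈⟨ trans (*-congˡ (zeroʳ _)) (zeroʳ _) ⟨
        (σ N * σ a * q^ B) * (q^ T * 0#)       ≈⟨ *-congˡ (*-congˡ (g-> N a N<a)) ⟨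
        (σ N * σ a * q^ B) * (q^ T * g N a)    ∎

    -- The largest possible β-number is `suc b + L`, here 2N. `IH₁` covers the lists that avoid it
    -- and `IH₂` those that begin with it; the two are the terms of Pascal's rule for the binomial
    -- of the even β-numbers.
    step-even : ∀ b L N → suc b ℕ.+ L ≡ N ℕ.+ N → Formula b (suc L) N N → Formula (suc b) L N N →
                Formula (suc b) (suc L) (suc N) N
    step-even b L N β≡ IH₁ IH₂ ω = begin
      ∑ b (suc L) (F (suc L)) + ∑ (suc b) L (λ c → F (suc L) (suc b ∷ c))
        ≈⟨ +-cong (IH₁ ω) (trans (∑-cong (suc b) L cons) (IH₂ ω′)) ⟩
      (ω 0 (suc L) * (q^ (t 0 (suc L)) * (1# * g N (suc L))) + diag L P) + diag L (λ a a′ → ω′ a a′ * (q^ (t a a′) * (g N a * g N a′)))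
        ≈⟨ +-assoc _ _ _ ⟩
      ω 0 (suc L) * (q^ (t 0 (suc L)) * (1# * g N (suc L))) + (diag L P + diag L (λ a a′ → ω′ a a′ * (q^ (t a a′) * (g N a * g N a′))))
        ≈⟨ +-congˡ (diag-+ L P _) ⟨
      ω 0 (suc L) * (q^ (t 0 (suc L)) * (1# * g N (suc L))) + diag L (λ a a′ → P a a′ + ω′ a a′ * (q^ (t a a′) * (g N a * g N a′)))
        ≈⟨ +-congˡ (diag-cong L pascal) ⟩
      ω 0 (suc L) * (q^ (t 0 (suc L)) * (1# * g N (suc L))) + diag L (λ a a′ → ω (suc a) a′ * (q^ (t (suc a) a′) * (g (suc N) (suc a) * g N a′))) ∎
      where
      F : ℕ → List ℕ → Carrier
      F L c = ω (count true L c) (count false L c) * weight L c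

      ω′ P : ℕ → ℕ → Carrier
      ω′ a a′ = ω (suc a) a′ * (σ N * σ a * q^ (suc b))
      P a a′ = ω (suc a) a′ * (q^ (t (suc a) a′) * (g N (suc a) * g N a′))

      cons : ∀ c → F (suc L) (suc b ∷ c) ≈ ω′ (count true L c) (count false L c) * weight L c
      cons c = trans
        (reflexive (cong₂ (λ B v → ω (tick B true ℕ.+ count true L c) (tick B false ℕ.+ count false L c)
                                   * (σ v * σ (count B L c) * q^ (suc b) * weight L c))
          (≡.trans (cong parity β≡) (parity-double N)) (≡.trans (cong ⌊_/2⌋ β≡) (≡.sym (ℕₚ.n≡⌊n+n/2⌋ N)))))
        (sym (*-assoc _ _ _))

      pascal : ∀ a a′ → a ℕ.+ a′ ≡ L → P a a′ + ω′ a a′ * (q^ (t a a′) * (g N a * g N a′)) ≈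
               ω (suc a) a′ * (q^ (t (suc a) a′) * (g (suc N) (suc a) * g N a′))
      pascal a a′ a+a′≡L = sym (begin
        ω (suc a) a′ * (q^ (t (suc a) a′) * ((g N (suc a) + x₂ (N ∸ a) * g N a) * g N a′))
          ≈⟨ solve 6 (λ w s u v z y → w :* (s :* ((u :+ v :* z) :* y)) := w :* (s :* (u :* y)) :+ (w :* (s :* (v :* z))) :* y) refl _ _ _ _ _ _ ⟩
        P a a′ + (ω (suc a) a′ * (q^ (t (suc a) a′) * (x₂ (N ∸ a) * g N a))) * g N a′
          ≈⟨ +-congˡ (*-congʳ (*-congˡ (x₂*g N a (suc b) (t a a′) _ (t-sucˡ-shift (suc b) a a′ N (≡.trans (cong (suc b ℕ.+_) a+a′≡L) β≡))))) ⟩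
        P a a′ + (ω (suc a) a′ * ((σ N * σ a * q^ (suc b)) * (q^ (t a a′) * g N a))) * g N a′
          ≈⟨ +-congˡ (solve 5 (λ w s u v y → (w :* (s :* (u :* v))) :* y := (w :* s) :* (u :* (v :* y))) refl _ _ _ _ _) ⟩
        P a a′ + ω′ a a′ * (q^ (t a a′) * (g N a * g N a′)) ∎)

    -- Now Pascal's rule acts on the odd binomial. The index that advances is `a′`, so the term set
    -- apart is `a′ = 0`, at the far end of the diagonal, whence `diag-last`.
    step-odd : ∀ b L N → suc b ℕ.+ L ≡ suc (N ℕ.+ N) → Formula b (suc L) (suc N) N → Formula (suc b) L (suc N) N →
               Formula (suc b) (suc L) (suc N) (suc N)
    step-odd b L N β≡ IH₁ IH₂ ω = begin
      ∑ b (suc L) (F (suc L)) + ∑ (suc b) L (λ c → F (suc L) (suc b ∷ c))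
        ≈⟨ +-cong (trans (IH₁ ω) (diag-last L (λ a a′ → ω a a′ * (q^ (t a a′) * (g (suc N) a * g N a′))))) (trans (∑-cong (suc b) L cons) (IH₂ ω′)) ⟩
      (diag L P + last) + diag L (λ a a′ → ω′ a a′ * (q^ (t a a′) * (g (suc N) a * g N a′)))
        ≈⟨ solve 3 (λ u v w → (u :+ v) :+ w := (u :+ w) :+ v) refl _ _ _ ⟩
      (diag L P + diag L (λ a a′ → ω′ a a′ * (q^ (t a a′) * (g (suc N) a * g N a′)))) + last
        ≈⟨ +-congʳ (diag-+ L P _) ⟨
      diag L (λ a a′ → P a a′ + ω′ a a′ * (q^ (t a a′) * (g (suc N) a * g N a′))) + last
        ≈⟨ +-congʳ (diag-cong L pascal) ⟩
      diag L (λ a a′ → ω a (suc a′) * (q^ (t a (suc a′)) * (g (suc N) a * g (suc N) (suc a′)))) + last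
        ≈⟨ diag-last L (λ a a′ → ω a a′ * (q^ (t a a′) * (g (suc N) a * g (suc N) a′))) ⟨
      diag (suc L) (λ a a′ → ω a a′ * (q^ (t a a′) * (g (suc N) a * g (suc N) a′))) ∎
      where
      F : ℕ → List ℕ → Carrier
      F L c = ω (count true L c) (count false L c) * weight L c

      last : Carrier
      last = ω (suc L) 0 * (q^ (t (suc L) 0) * (g (suc N) (suc L) * 1#))

      ω′ P : ℕ → ℕ → Carrier
      ω′ a a′ = ω a (suc a′) * (σ N * σ a′ * q^ (suc b))
      P a a′ = ω a (suc a′) * (q^ (t a (suc a′)) * (g (suc N) a * g N (suc a′)))

      cons : ∀ c → F (suc L) (suc b ∷ c) ≈ ω′ (count true L c) (count false L c) * weight L c
      cons c = trans
        (reflexive (cong₂ (λ B v → ω (tick B true ℕ.+ count true L c) (tick B false ℕ.+ count false L c)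
                                   * (σ v * σ (count B L c) * q^ (suc b) * weight L c))
          (≡.trans (cong parity β≡) (cong not (parity-double N))) (≡.trans (cong ⌊_/2⌋ β≡) (⌊1+k+k/2⌋ N))))
        (sym (*-assoc _ _ _))

      pascal : ∀ a a′ → a ℕ.+ a′ ≡ L → P a a′ + ω′ a a′ * (q^ (t a a′) * (g (suc N) a * g N a′)) ≈
               ω a (suc a′) * (q^ (t a (suc a′)) * (g (suc N) a * g (suc N) (suc a′)))
      pascal a a′ a+a′≡L = sym (begin
        ω a (suc a′) * (q^ (t a (suc a′)) * (g (suc N) a * (g N (suc a′) + x₂ (N ∸ a′) * g N a′)))
          ≈⟨ solve 6 (λ w s u v z y → w :* (s :* (y :* (u :+ v :* z))) := w :* (s :* (y :* u)) :+ (w :* (s :* (v :* z))) :* y) refl _ _ _ _ _ _ ⟩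
        P a a′ + (ω a (suc a′) * (q^ (t a (suc a′)) * (x₂ (N ∸ a′) * g N a′))) * g (suc N) a
          ≈⟨ +-congˡ (*-congʳ (*-congˡ (x₂*g N a′ (suc b) (t a a′) _ (t-sucʳ-shift (suc b) a a′ N (≡.trans (cong (suc b ℕ.+_) a+a′≡L) β≡))))) ⟩
        P a a′ + (ω a (suc a′) * ((σ N * σ a′ * q^ (suc b)) * (q^ (t a a′) * g N a′))) * g (suc N) a
          ≈⟨ +-congˡ (solve 5 (λ w s u v y → (w :* (s :* (u :* v))) :* y := (w :* s) :* (u :* (y :* v))) refl _ _ _ _ _) ⟩
        P a a′ + ω′ a a′ * (q^ (t a a′) * (g (suc N) a * g N a′)) ∎)

    -- Only the empty partition occurs, and it uses all the even and all the odd numbers below L. On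
    -- the other side every other term of the diagonal has a binomial with too large a lower index.
    formula-zero : ∀ L → Formula 0 L ⌈ L /2⌉ ⌊ L /2⌋
    formula-zero L ω = begin
      ∑ 0 L F                                                        ≈⟨ ∑-zero L ⟩
      ω (count true L []) (count false L []) * 1#                    ≈⟨ *-identityʳ _ ⟩
      ω (count true L []) (count false L [])                         ≈⟨ reflexive (cong₂ ω (count-true-[] L) (count-false-[] L)) ⟩
      ω N₀ N₁                                                        ≈⟨ trans (*-congˡ unit) (*-identityʳ _) ⟨
      h N₀ N₁                                                        ≈⟨ diag-single N₀ N₁ h left right ⟨
      diag (N₀ ℕ.+ N₁) h                                             ≈⟨ reflexive (cong (λ m → diag m h) (≡.trans (ℕₚ.+-comm N₀ N₁) (ℕₚ.⌊n/2⌋+⌈n/2⌉≡n L))) ⟩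
      diag L h                                                       ∎
      where
      N₀ = ⌈ L /2⌉
      N₁ = ⌊ L /2⌋

      F : List ℕ → Carrier
      F c = ω (count true L c) (count false L c) * weight L c

      h : ℕ → ℕ → Carrier
      h a a′ = ω a a′ * (q^ (t a a′) * (g N₀ a * g N₁ a′))

      ∑-zero : ∀ K {F} → ∑ 0 K F ≈ F []
      ∑-zero zero = refl
      ∑-zero (suc K) = refl

      unit : q^ (t N₀ N₁) * (g N₀ N₀ * g N₁ N₁) ≈ 1#
      unit = begin
        q^ (t N₀ N₁) * (g N₀ N₀ * g N₁ N₁)   ≈⟨ *-cong (trans (q^-cong (t-balanced L)) q^-zero) (*-cong (g-diagonal N₀) (g-diagonal N₁)) ⟩
        1# * (1# * 1#)                       ≈⟨ trans (*-identityˡ _) (*-identityˡ 1#) ⟩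
        1#                                   ∎

      left : ∀ a a′ → N₀ < a → h a a′ ≈ 0#
      left a a′ N₀<a = begin
        ω a a′ * (q^ (t a a′) * (g N₀ a * g N₁ a′))   ≈⟨ *-congˡ (*-congˡ (*-congʳ (g-> N₀ a N₀<a))) ⟩
        ω a a′ * (q^ (t a a′) * (0# * g N₁ a′))       ≈⟨ *-congˡ (trans (*-congˡ (zeroˡ _)) (zeroʳ _)) ⟩
        ω a a′ * 0#                                   ≈⟨ zeroʳ _ ⟩
        0#                                            ∎

      right : ∀ a a′ → N₁ < a′ → h a a′ ≈ 0#
      right a a′ N₁<a′ = begin
        ω a a′ * (q^ (t a a′) * (g N₀ a * g N₁ a′))   ≈⟨ *-congˡ (*-congˡ (*-congˡ (g-> N₁ a′ N₁<a′))) ⟩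
        ω a a′ * (q^ (t a a′) * (g N₀ a * 0#))        ≈⟨ *-congˡ (trans (*-congˡ (zeroʳ _)) (zeroʳ _)) ⟩
        ω a a′ * 0#                                   ≈⟨ zeroʳ _ ⟩
        0#                                            ∎

    formula-empty : ∀ b N₀ N₁ → Formula b 0 N₀ N₁
    formula-empty b N₀ N₁ ω = *-congˡ (sym (begin
      q^ 0 * (1# * 1#)   ≈⟨ *-cong q^-zero (*-identityˡ 1#) ⟩
      1# * 1#            ≈⟨ *-identityˡ 1# ⟩
      1#                 ∎))

    -- `N₀` and `N₁` count the even and the odd numbers below `b + L`, the range of the β-numbers.
    -- Both recursive calls have the same, one shorter, range. Equations in place of computed
    -- indices let them be made at `N` and `suc N` directly.
    formula : ∀ b L N₀ N₁ → ⌈ b ℕ.+ L /2⌉ ≡ N₀ → ⌊ b ℕ.+ L /2⌋ ≡ N₁ → Formula b L N₀ N₁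
    formula b zero N₀ N₁ _ _ = formula-empty b N₀ N₁
    formula zero (suc L) _ _ ≡.refl ≡.refl = formula-zero (suc L)
    formula (suc b) (suc L) N₀ N₁ N₀≡ N₁≡ = [ even , odd ]′ (even⊎odd (suc b ℕ.+ L))
      where
      β+1≡ : ∀ {β} → suc b ℕ.+ L ≡ β → suc b ℕ.+ suc L ≡ suc β
      β+1≡ β≡ = ≡.trans (ℕₚ.+-suc (suc b) L) (cong suc β≡)

      β≡′ : ∀ {β} → suc b ℕ.+ L ≡ β → b ℕ.+ suc L ≡ β
      β≡′ β≡ = ≡.trans (ℕₚ.+-suc b L) β≡

      even : ∃ (λ N → suc b ℕ.+ L ≡ N ℕ.+ N) → Formula (suc b) (suc L) N₀ N₁
      even (N , β≡) = subst₂ (Formula (suc b) (suc L))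
        (≡.trans (≡.sym (≡.trans (cong ⌈_/2⌉ (β+1≡ β≡)) (cong suc ⌊N+N/2⌋≡N))) N₀≡)
        (≡.trans (≡.sym (≡.trans (cong ⌊_/2⌋ (β+1≡ β≡)) (⌊1+k+k/2⌋ N))) N₁≡)
        (step-even b L N β≡
          (formula b (suc L) N N (≡.trans (cong ⌈_/2⌉ (β≡′ β≡)) (⌊1+k+k/2⌋ N)) (≡.trans (cong ⌊_/2⌋ (β≡′ β≡)) ⌊N+N/2⌋≡N))
          (formula (suc b) L N N (≡.trans (cong ⌈_/2⌉ β≡) (⌊1+k+k/2⌋ N)) (≡.trans (cong ⌊_/2⌋ β≡) ⌊N+N/2⌋≡N)))
        where
        ⌊N+N/2⌋≡N : ⌊ N ℕ.+ N /2⌋ ≡ N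
        ⌊N+N/2⌋≡N = ≡.sym (ℕₚ.n≡⌊n+n/2⌋ N)

      odd : ∃ (λ N → suc b ℕ.+ L ≡ suc (N ℕ.+ N)) → Formula (suc b) (suc L) N₀ N₁
      odd (N , β≡) = subst₂ (Formula (suc b) (suc L))
        (≡.trans (≡.sym (≡.trans (cong ⌈_/2⌉ (β+1≡ β≡)) (cong suc (⌊1+k+k/2⌋ N)))) N₀≡)
        (≡.trans (≡.sym (≡.trans (cong ⌊_/2⌋ (β+1≡ β≡)) (cong suc ⌊N+N/2⌋≡N))) N₁≡)
        (step-odd b L N β≡
          (formula b (suc L) (suc N) N (≡.trans (cong ⌈_/2⌉ (β≡′ β≡)) (cong suc ⌊N+N/2⌋≡N)) (≡.trans (cong ⌊_/2⌋ (β≡′ β≡)) (⌊1+k+k/2⌋ N)))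
          (formula (suc b) L (suc N) N (≡.trans (cong ⌈_/2⌉ β≡) (cong suc ⌊N+N/2⌋≡N)) (≡.trans (cong ⌊_/2⌋ β≡) (⌊1+k+k/2⌋ N))))
        where
        ⌊N+N/2⌋≡N : ⌊ N ℕ.+ N /2⌋ ≡ N
        ⌊N+N/2⌋≡N = ≡.sym (ℕₚ.n≡⌊n+n/2⌋ N)

    ∑-weight : ∑ n n (weight n) ≈ A n * (P₄.Y n * (O n * O n))
    ∑-weight = begin
      ∑ n n (weight n)
        ≈⟨ ∑-cong n n (λ c → *-identityˡ _) ⟨
      ∑ n n (λ c → 1# * weight n c)
        ≈⟨ formula n n n n (≡.sym (ℕₚ.n≡⌈n+n/2⌉ n)) (≡.sym (ℕₚ.n≡⌊n+n/2⌋ n)) (λ _ _ → 1#) ⟩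
      diag n (λ a a′ → 1# * (q^ (t a a′) * (g n a * g n a′)))
        ≈⟨ diag-cong n (λ a a′ _ → *-identityˡ _) ⟩
      diag n (λ a a′ → q^ (t a a′) * (g n a * g n a′))
        ≈⟨ diag-gg≈product ⟩
      A n * (P₄.Y n * (O n * O n)) ∎

    weight≈sign : ∀ {b L c} → Bounded b L c → weight L c ≈ σ (evenHooks c) * q^ (sum c)
    weight≈sign [] = sym (trans (*-identityˡ _) q^-zero)
    weight≈sign {b} {suc L} {x ∷ c} (x≤b ∷ bounded) = begin
      σ ⌊ x ℕ.+ L /2⌋ * σ m * q^ x * weight L c
        ≈⟨ *-cong (*-congʳ sign) (weight≈sign bounded) ⟩
      σ r * q^ x * (σ (evenHooks c) * q^ (sum c))
        ≈⟨ solve 4 (λ s u v w → (s :* u) :* (v :* w) := (s :* v) :* (u :* w)) refl (σ r) (q^ x) (σ (evenHooks c)) (q^ (sum c)) ⟩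
      (σ r * σ (evenHooks c)) * (q^ x * q^ (sum c))
        ≈⟨ *-cong (trans (sym (σ-+ r (evenHooks c))) (reflexive (cong σ (≡.sym (evenHooks-∷ bounded))))) (sym (q^-+ x (sum c))) ⟩
      σ (evenHooks (x ∷ c)) * q^ (sum (x ∷ c)) ∎
      where
      m r : ℕ
      m = count (parity (x ℕ.+ L)) L c
      r = rowEven x c

      sign : σ ⌊ x ℕ.+ L /2⌋ * σ m ≈ σ r
      sign = begin
        -- By `rowCount` the floor is `r + m`; the second `σ m` undoes the first, so the subtraction
        -- never has to be carried out.
        σ ⌊ x ℕ.+ L /2⌋ * σ m   ≈⟨ *-congʳ (trans (reflexive (cong σ (≡.sym (proj₁ (rowCount bounded))))) (σ-+ r m)) ⟩
        σ r * σ m * σ m         ≈⟨ *-assoc _ _ _ ⟩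
        σ r * (σ m * σ m)       ≈⟨ *-congˡ (σ-square m) ⟩
        σ r * 1#                ≈⟨ *-identityʳ _ ⟩
        σ r                     ∎

    ∑-sign : ∑ n n (λ c → σ (evenHooks c) * q^ (sum c)) ≈ A n * (P₄.Y n * (O n * O n))
    ∑-sign = trans (sym (∑-cong-Bounded n n (λ c bounded → weight≈sign bounded))) ∑-weight

-- Sums over the list of candidates

sumOver : ∀ {A : Set} → (A → ℤ) → List A → ℤ
sumOver F [] = + 0
sumOver F (x ∷ xs) = F x ℤ.+ sumOver F xs

sumOver-++ : ∀ {A : Set} (F : A → ℤ) xs ys → sumOver F (xs ++ ys) ≡ sumOver F xs ℤ.+ sumOver F ys
sumOver-++ F [] ys = ≡.sym (ℤₚ.+-identityˡ _)
sumOver-++ F (x ∷ xs) ys = ≡.trans (cong (λ z → F x ℤ.+ z) (sumOver-++ F xs ys)) (≡.sym (ℤₚ.+-assoc (F x) _ _))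

sumOver-map : ∀ {A B : Set} (F : B → ℤ) (h : A → B) xs → sumOver F (map h xs) ≡ sumOver (F ∘ h) xs
sumOver-map F h [] = ≡.refl
sumOver-map F h (x ∷ xs) = cong (λ z → F (h x) ℤ.+ z) (sumOver-map F h xs)

sumOver-cong : ∀ {A : Set} {F G : A → ℤ} → (∀ x → F x ≡ G x) → ∀ xs → sumOver F xs ≡ sumOver G xs
sumOver-cong F≡G [] = ≡.refl
sumOver-cong F≡G (x ∷ xs) = cong₂ ℤ._+_ (F≡G x) (sumOver-cong F≡G xs)

sumOver-zero : ∀ {A : Set} {F : A → ℤ} → (∀ x → F x ≡ + 0) → ∀ xs → sumOver F xs ≡ + 0
sumOver-zero F≡0 [] = ≡.refl
sumOver-zero F≡0 (x ∷ xs) = cong₂ ℤ._+_ (F≡0 x) (sumOver-zero F≡0 xs)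

sumOver-filter : ∀ {A : Set} (P : A → Bool) (F : A → ℤ) xs →
  sumOver F (filter (λ x → P x Bool.≟ true) xs) ≡ sumOver (λ x → [ P x ] ℤ.* F x) xs
sumOver-filter P F [] = ≡.refl
sumOver-filter P F (x ∷ xs) with P x
... | true  = cong₂ ℤ._+_ (≡.sym (ℤₚ.*-identityˡ (F x))) (sumOver-filter P F xs)
... | false = ≡.trans (sumOver-filter P F xs) (≡.sym (ℤₚ.+-identityˡ _))

signPow-parity : ∀ k → signPow k ≡ (if parity k then + 1 else ℤ.- (+ 1))
signPow-parity zero = ≡.refl
signPow-parity (suc k) with parity k | signPow-parity k
... | true  | eq = cong ℤ.-_ eq
... | false | eq = cong ℤ.-_ eq

even-minus-odd : ∀ {A : Set} (h : A → ℕ) xs →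
  + length (filter (λ x → evenᵇ (h x) Bool.≟ true) xs) ℤ.- + length (filter (λ x → evenᵇ (h x) Bool.≟ false) xs)
  ≡ sumOver (signPow ∘ h) xs
even-minus-odd h [] = ≡.refl
even-minus-odd h (x ∷ xs)
  with evenᵇ (h x) | ≡.trans (signPow-parity (h x)) (cong (λ B → if B then + 1 else ℤ.- (+ 1)) (≡.sym (evenᵇ≡parity (h x))))
... | true | sign = begin
  (+ 1 ℤ.+ e) ℤ.- o                     ≡⟨ ℤₚ.+-assoc (+ 1) e (ℤ.- o) ⟩
  + 1 ℤ.+ (e ℤ.- o)                     ≡⟨ cong₂ ℤ._+_ (≡.sym sign) (even-minus-odd h xs) ⟩
  signPow (h x) ℤ.+ sumOver (signPow ∘ h) xs ∎
  where
  open ≡.≡-Reasoning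
  e o : ℤ
  e = + length (filter (λ x → evenᵇ (h x) Bool.≟ true) xs)
  o = + length (filter (λ x → evenᵇ (h x) Bool.≟ false) xs)
... | false | sign = begin
  e ℤ.- (+ 1 ℤ.+ o)                     ≡⟨ regroup e o ⟩
  ℤ.- (+ 1) ℤ.+ (e ℤ.- o)               ≡⟨ cong₂ ℤ._+_ (≡.sym sign) (even-minus-odd h xs) ⟩
  signPow (h x) ℤ.+ sumOver (signPow ∘ h) xs ∎
  where
  open ≡.≡-Reasoning
  e o : ℤ
  e = + length (filter (λ x → evenᵇ (h x) Bool.≟ true) xs)
  o = + length (filter (λ x → evenᵇ (h x) Bool.≟ false) xs)
  regroup : ∀ e o → e ℤ.- (+ 1 ℤ.+ o) ≡ ℤ.- (+ 1) ℤ.+ (e ℤ.- o)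
  regroup = ℤSolver.solve-∀

-- Peels off the last index, just as `∑` peels off the largest value of the first part.
sumTo : ℕ → (ℕ → ℤ) → ℤ
sumTo zero h = + 0
sumTo (suc k) h = sumTo k h ℤ.+ h k

sumTo-cong : ∀ k {h h′} → (∀ i → i < k → h i ≡ h′ i) → sumTo k h ≡ sumTo k h′
sumTo-cong zero _ = ≡.refl
sumTo-cong (suc k) h≡h′ = cong₂ ℤ._+_ (sumTo-cong k (λ i i<k → h≡h′ i (ℕₚ.m≤n⇒m≤1+n i<k))) (h≡h′ k ℕₚ.≤-refl)

sumTo-extend : ∀ d y h → (∀ i → y ≤ i → h i ≡ + 0) → sumTo (d ℕ.+ y) h ≡ sumTo y h
sumTo-extend zero y h _ = ≡.refl
sumTo-extend (suc d) y h h≡0 = ≡.trans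
  (cong₂ ℤ._+_ (sumTo-extend d y h h≡0) (h≡0 (d ℕ.+ y) (ℕₚ.m≤n+m y d))) (ℤₚ.+-identityʳ _)

sumOver-concatMap : ∀ {A : Set} (F : A → ℤ) (G : ℕ → List A) k →
  sumOver F (concatMap G (applyUpTo suc k)) ≡ sumTo k (λ i → sumOver F (G (suc i)))
sumOver-concatMap F G zero = ≡.refl
sumOver-concatMap F G (suc k) = begin
  sumOver F (concatMap G (applyUpTo suc (suc k)))                 ≡⟨ cong (sumOver F ∘ concatMap G) (applyUpTo-∷ʳ suc k) ⟨
  sumOver F (concatMap G (applyUpTo suc k ∷ʳ suc k))              ≡⟨ cong (sumOver F) (concatMap-++ G (applyUpTo suc k) _) ⟩
  sumOver F (concatMap G (applyUpTo suc k) ++ (G (suc k) ++ []))  ≡⟨ sumOver-++ F (concatMap G (applyUpTo suc k)) _ ⟩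
  sumOver F (concatMap G (applyUpTo suc k)) ℤ.+ sumOver F (G (suc k) ++ [])
    ≡⟨ cong₂ ℤ._+_ (sumOver-concatMap F G k) (cong (sumOver F) (++-identityʳ (G (suc k)))) ⟩
  sumTo (suc k) (λ i → sumOver F (G (suc i)))                     ∎
  where open ≡.≡-Reasoning

sumOver-candidates : ∀ F b L → sumOver F (candidates b (suc L)) ≡
  F [] ℤ.+ sumTo b (λ i → sumOver (λ c → F (suc i ∷ c)) (candidates b L))
sumOver-candidates F b L = cong (λ z → F [] ℤ.+ z) (≡.trans
  (sumOver-concatMap F (λ x → map (x ∷_) (candidates b L)) b)
  (sumTo-cong b (λ i _ → sumOver-map F (suc i ∷_) (candidates b L))))

-- The bound on the first entry is what allows `n` to be written in front of a list without
-- affecting whether it decreases.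
sumOver-candidates-cong : ∀ b L {F G} → F [] ≡ G [] → (∀ x c → x ≤ b → F (x ∷ c) ≡ G (x ∷ c)) →
  sumOver F (candidates b L) ≡ sumOver G (candidates b L)
sumOver-candidates-cong b zero F≡G-[] F≡G-∷ = cong (ℤ._+ (+ 0)) F≡G-[]
sumOver-candidates-cong b (suc L) {F} {G} F≡G-[] F≡G-∷ = begin
  sumOver F (candidates b (suc L))
    ≡⟨ sumOver-candidates F b L ⟩
  F [] ℤ.+ sumTo b (λ i → sumOver (λ c → F (suc i ∷ c)) (candidates b L))
    ≡⟨ cong₂ ℤ._+_ F≡G-[] (sumTo-cong b (λ i i<b → sumOver-cong (λ c → F≡G-∷ (suc i) c i<b) (candidates b L))) ⟩
  G [] ℤ.+ sumTo b (λ i → sumOver (λ c → G (suc i ∷ c)) (candidates b L))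
    ≡⟨ sumOver-candidates G b L ⟨
  sumOver G (candidates b (suc L)) ∎
  where open ≡.≡-Reasoning

≤⇒≤ᵇ≡true : ∀ {m n} → m ≤ n → (m ≤ᵇ n) ≡ true
≤⇒≤ᵇ≡true m≤n = Equivalence.to T-≡ (ℕₚ.≤⇒≤ᵇ m≤n)

>⇒≤ᵇ≡false : ∀ {m n} → n < m → (m ≤ᵇ n) ≡ false
>⇒≤ᵇ≡false {m} {n} n<m with m ≤ᵇ n in eq
... | false = ≡.refl
... | true  = contradiction (ℕₚ.≤ᵇ⇒≤ m n (Equivalence.from T-≡ eq)) (ℕₚ.<⇒≱ n<m)

-- The coefficient of q^n on both sides

module Coefficients (n : ℕ) where
  open CommutativeRing (truncatedRing n) using (_≈_; ring; *-cong; reflexive; setoid; commutativeSemiring) renaming (refl to ≈-refl)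
  open Algebra (truncatedRing n)

  -- `candidates` keeps the bound `b` at every position while `∑` lowers it to the preceding part.
  -- The prefixed `y` stands for that part: first entries above `y` are rejected by the test, and
  -- the others give the rows of `∑`.
  candidates-∑ : ∀ b y L (F : List ℕ → Series) → y ≤ b →
    sumOver (λ c → [ decreasingᵇ (y ∷ c) ∧ positiveᵇ c ] ℤ.* F c n) (candidates b L) ≡ ∑ y L F n
  candidates-∑ b y zero F y≤b = ≡.trans (ℤₚ.+-identityʳ _) (ℤₚ.*-identityˡ (F [] n))
  candidates-∑ b y (suc L) F y≤b = begin
    sumOver (λ c → [ decreasingᵇ (y ∷ c) ∧ positiveᵇ c ] ℤ.* F c n) (candidates b (suc L))
      ≡⟨ sumOver-candidates (λ c → [ decreasingᵇ (y ∷ c) ∧ positiveᵇ c ] ℤ.* F c n) b L ⟩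
    + 1 ℤ.* F [] n ℤ.+ sumTo b row
      ≡⟨ cong₂ ℤ._+_ (ℤₚ.*-identityˡ (F [] n)) (≡.trans (cong (λ z → sumTo z row) (≡.sym (ℕₚ.m∸n+n≡m y≤b))) (sumTo-extend (b ∸ y) y row large)) ⟩
    F [] n ℤ.+ sumTo y row
      ≡⟨ cong (λ z → F [] n ℤ.+ z) (sumTo-cong y small) ⟩
    F [] n ℤ.+ sumTo y (λ i → ∑ (suc i) L (λ c → F (suc i ∷ c)) n)
      ≡⟨ ∑-rows y ⟨
    ∑ y (suc L) F n ∎
    where
    open ≡.≡-Reasoning
    row : ℕ → ℤ
    row i = sumOver (λ c → [ ((suc i ≤ᵇ y) ∧ decreasingᵇ (suc i ∷ c)) ∧ positiveᵇ c ] ℤ.* F (suc i ∷ c) n) (candidates b L)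

    large : ∀ i → y ≤ i → row i ≡ + 0
    large i y≤i = sumOver-zero (λ c → cong (λ B → [ (B ∧ decreasingᵇ (suc i ∷ c)) ∧ positiveᵇ c ] ℤ.* F (suc i ∷ c) n)
      (>⇒≤ᵇ≡false (s≤s y≤i))) (candidates b L)

    small : ∀ i → i < y → row i ≡ ∑ (suc i) L (λ c → F (suc i ∷ c)) n
    small i i<y = ≡.trans
      (sumOver-cong (λ c → cong (λ B → [ (B ∧ decreasingᵇ (suc i ∷ c)) ∧ positiveᵇ c ] ℤ.* F (suc i ∷ c) n) (≤⇒≤ᵇ≡true i<y)) (candidates b L))
      (candidates-∑ b (suc i) L (λ c → F (suc i ∷ c)) (ℕₚ.≤-trans i<y y≤b))

    ∑-rows : ∀ y → ∑ y (suc L) F n ≡ F [] n ℤ.+ sumTo y (λ i → ∑ (suc i) L (λ c → F (suc i ∷ c)) n)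
    ∑-rows zero = ≡.sym (ℤₚ.+-identityʳ _)
    ∑-rows (suc y) = ≡.trans (cong (ℤ._+ ∑ (suc y) L (λ c → F (suc y ∷ c)) n) (∑-rows y)) (ℤₚ.+-assoc (F [] n) _ _)

  σ-⊛ : ∀ k a → (σ k ⊛ a) n ≡ signPow k ℤ.* a n
  σ-⊛ zero a = ≡.trans (oneS-⊛ a n) (≡.sym (ℤₚ.*-identityˡ (a n)))
  σ-⊛ (suc k) a = begin
    ((⊖ σ k) ⊛ a) n            ≡⟨ coeff (RingProperties.-‿distribˡ-* ring (σ k) a) n ℕₚ.≤-refl ⟨
    ℤ.- (σ k ⊛ a) n            ≡⟨ cong ℤ.-_ (σ-⊛ k a) ⟩
    ℤ.- (signPow k ℤ.* a n)    ≡⟨ ℤₚ.neg-distribˡ-* (signPow k) (a n) ⟩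
    signPow (suc k) ℤ.* a n    ∎
    where open ≡.≡-Reasoning

  4[1+i]∸2 : ∀ i → 4 ℕ.* suc i ∸ 2 ≡ 2 ℕ.+ 4 ℕ.* i
  4[1+i]∸2 i = cong (_∸ 2) (ℕₚ.*-suc 4 i)

  open Truncated mono (everywhere (λ _ → ≡.refl)) (λ i j → everywhere (mono-+ i j))
    -- The inverses are written exactly as in `factor`, so only the exponent of the numerator has to
    -- be adjusted in `partialProd≈`.
    (λ i → invOneMinus (4 ℕ.* suc i)) (λ i → invOnePlus (4 ℕ.* suc i ∸ 2))
    -- `i + 3 * suc i` is the predecessor of `4 * suc i`, to which that product unfolds; `1 + 4 * i`
    -- below is that of `2 + 4 * i`.
    (λ i → geometric-minus (mono (4 ℕ.* suc i)) (invOneMinus (4 ℕ.* suc i)) (everywhere (invOneMinus-unfold (i ℕ.+ 3 ℕ.* suc i))))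
    (λ i → subst (λ m → ((oneS ⊕ mono (2 ℕ.+ 4 ℕ.* i)) ⊛ invOnePlus m) ≈ oneS) (≡.sym (4[1+i]∸2 i))
      (geometric-plus (mono (2 ℕ.+ 4 ℕ.* i)) (invOnePlus (2 ℕ.+ 4 ℕ.* i)) (everywhere (invOnePlus-unfold (1 ℕ.+ 4 ℕ.* i)))))
    n (λ i n<i → agree (λ k k≤n → mono-zero i k (ℕₚ.≤-<-trans k≤n n<i)))

  partialProd≈ : ∀ m → partialProd m ≈ (A m ⊛ (P₄.Y m ⊛ (O m ⊛ O m)))
  partialProd≈ zero = everywhere (λ k → ≡.sym (≡.trans (oneS-⊛ (oneS ⊛ (oneS ⊛ oneS)) k) (≡.trans (oneS-⊛ (oneS ⊛ oneS) k) (oneS-⊛ oneS k))))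
  partialProd≈ (suc m) = begin
    partialProd m ⊛ factor (suc m)
      ≈⟨ *-cong (partialProd≈ m) (reflexive factor≡) ⟩
    (A m ⊛ (P₄.Y m ⊛ (O m ⊛ O m))) ⊛ ((oneS ⊕ mono (suc (2 ℕ.* m))) ⊛ (e ⊛ (o ⊛ o)))
      ≈⟨ solve 6 (λ a y v b e o → (a :* (y :* (v :* v))) :* (b :* (e :* (o :* o))) := (a :* b) :* ((y :* e) :* ((v :* o) :* (v :* o))))
           ≈-refl (A m) (P₄.Y m) (O m) (oneS ⊕ mono (suc (2 ℕ.* m))) e o ⟩
    A (suc m) ⊛ (P₄.Y (suc m) ⊛ (O (suc m) ⊛ O (suc m))) ∎
    where
    open SetoidReasoning setoid
    open NaturalCoefficients commutativeSemiring using (solve; _:*_; _:=_)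
    e o : Series
    e = invOneMinus (4 ℕ.* suc m)
    o = invOnePlus (4 ℕ.* suc m ∸ 2)
    factor≡ : factor (suc m) ≡ (oneS ⊕ mono (suc (2 ℕ.* m))) ⊛ (e ⊛ (o ⊛ o))
    factor≡ = cong (λ j → (oneS ⊕ mono j) ⊛ (e ⊛ (o ⊛ o))) (ℕₚ.+-suc m (m ℕ.+ 0))

  -- The condition on the size moves from the filter into a coefficient of `mono (sum c)`, since `∑`
  -- ranges over partitions of all sizes.
  term : ∀ c → [ decreasingᵇ c ∧ positiveᵇ c ∧ (sum c ≡ᵇ n) ] ℤ.* signPow (evenHooks c)
             ≡ [ decreasingᵇ c ∧ positiveᵇ c ] ℤ.* (σ (evenHooks c) ⊛ mono (sum c)) n
  term c = begin
    [ decreasingᵇ c ∧ positiveᵇ c ∧ (sum c ≡ᵇ n) ] ℤ.* s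
      ≡⟨ cong (λ B → [ B ] ℤ.* s) (∧-assoc (decreasingᵇ c) (positiveᵇ c) (sum c ≡ᵇ n)) ⟨
    [ (decreasingᵇ c ∧ positiveᵇ c) ∧ (sum c ≡ᵇ n) ] ℤ.* s
      ≡⟨ split (decreasingᵇ c ∧ positiveᵇ c) (sum c ≡ᵇ n) ⟩
    [ decreasingᵇ c ∧ positiveᵇ c ] ℤ.* (s ℤ.* [ sum c ≡ᵇ n ])
      ≡⟨ cong (λ B → [ decreasingᵇ c ∧ positiveᵇ c ] ℤ.* (s ℤ.* [ B ])) (≡ᵇ-sym (sum c) n) ⟩
    [ decreasingᵇ c ∧ positiveᵇ c ] ℤ.* (s ℤ.* mono (sum c) n)
      ≡⟨ cong ([ decreasingᵇ c ∧ positiveᵇ c ] ℤ.*_) (σ-⊛ (evenHooks c) (mono (sum c))) ⟨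
    [ decreasingᵇ c ∧ positiveᵇ c ] ℤ.* (σ (evenHooks c) ⊛ mono (sum c)) n ∎
    where
    open ≡.≡-Reasoning
    s : ℤ
    s = signPow (evenHooks c)
    split : ∀ B B′ → [ B ∧ B′ ] ℤ.* s ≡ [ B ] ℤ.* (s ℤ.* [ B′ ])
    split false B′ = ≡.refl
    split true true = ≡.sym (cong (+ 1 ℤ.*_) (ℤₚ.*-identityʳ s))
    split true false = ≡.sym (cong (+ 1 ℤ.*_) (ℤₚ.*-zeroʳ s))

  decreasingᵇ-∷ : ∀ x c → x ≤ n → decreasingᵇ (x ∷ c) ≡ decreasingᵇ (n ∷ x ∷ c)
  decreasingᵇ-∷ x c x≤n = cong (_∧ decreasingᵇ (x ∷ c)) (≡.sym (≤⇒≤ᵇ≡true x≤n))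

  signed-count : f n ≡ + numEvenEH n ℤ.- + numOddEH n
  signed-count = ≡.sym (begin
    + numEvenEH n ℤ.- + numOddEH n
      ≡⟨ even-minus-odd evenHooks (partitions n) ⟩
    sumOver (signPow ∘ evenHooks) (partitions n)
      ≡⟨ sumOver-filter (isPartitionOfᵇ n) (signPow ∘ evenHooks) (candidates n n) ⟩
    sumOver (λ c → [ isPartitionOfᵇ n c ] ℤ.* signPow (evenHooks c)) (candidates n n)
      -- `n` is put in front as the initial bound that `candidates-∑` expects; every candidate entry
      -- is at most `n`.
      ≡⟨ sumOver-candidates-cong n n (term []) (λ x c x≤n → ≡.trans (term (x ∷ c))
           (cong (λ B → [ B ∧ positiveᵇ (x ∷ c) ] ℤ.* (σ (evenHooks (x ∷ c)) ⊛ mono (sum (x ∷ c))) n) (decreasingᵇ-∷ x c x≤n))) ⟩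
    sumOver (λ c → [ decreasingᵇ (n ∷ c) ∧ positiveᵇ c ] ℤ.* (σ (evenHooks c) ⊛ mono (sum c)) n) (candidates n n)
      ≡⟨ candidates-∑ n n n (λ c → σ (evenHooks c) ⊛ mono (sum c)) ℕₚ.≤-refl ⟩
    ∑ n n (λ c → σ (evenHooks c) ⊛ mono (sum c)) n
      ≡⟨ coeff ∑-sign n ℕₚ.≤-refl ⟩
    (A n ⊛ (P₄.Y n ⊛ (O n ⊛ O n))) n
      ≡⟨ coeff (partialProd≈ n) n ℕₚ.≤-refl ⟨
    f n ∎)
    where open ≡.≡-Reasoning

open import Data.Integer using (_-_)

theorem3p4 : ∀ (n : ℕ) → f n ≡ (+ numEvenEH n) - (+ numOddEH n)
theorem3p4 n = Coefficients.signed-count n
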